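{- Let $k\ge3$ and $m\ge1$, and let $r,s$ be integers such that $1\le r\le\frac{(m-1)(k-2)+2}{k-1}$ and $1\le s\le k-1$. (a) The simplicial complex $\mathsf D_+(k,m)$ contains copies of the staircase triangulation $\Sigma(r,s)$ of the product of simplices $\Delta^{r-1}\times\Delta^{s-1}$. (b) The polytopal complex $\mathsf D(k,m)$ contains copies of the polytopal complex $\mathcal C(r,s)$.
   Context: Let $N=m(k-2)+2$ and consider a convex $N$-gon. $\delta(k,m)$ is the set of $k$-allowable diagonals: those that can appear in a dissection of the $N$-gon into $m$ convex $k$-gons. $I(k,m)$ is the graph on $\delta(k,m)$ in which two distinct diagonals are joined by an edge if their relative interiors do not intersect. For a loopless graph $H$ with $V(H)=[h]$: $\mathrm{Hom}(K_g,H)$ is the polytopal complex of all cells $\times_{i\in[g]}\sigma_i$ with $\emptyset\ne\sigma_i\subset V(H)$ such that for $i\ne j$ every $(u,v)\in\sigma_i\times\sigma_j$ is an edge of $H$; $\mathrm{Hom}_+(K_g,H)$ is the simplicial complex of all simplices $\star_{i\in[g]}\sigma_i$, $\sigma_i\subset V(H)$ possibly empty, with the same condition for all $i\ne j$ with both $\sigma_i,\sigma_j$ nonempty. Identify subsets of $V(H)$ with faces of $\Delta_{V(H)}=\mathrm{conv}\{e_1,\dots,e_h\}\subset\mathbb R^h$. The canonical projections of cells are $\pi(\times_i\sigma_i)=\frac1g(\sigma_1+\dots+\sigma_g)$ (Minkowski sum) and $\pi(\star_i\sigma_i)=\mathrm{conv}\bigcup_i\sigma_i$, and $\mathsf D(k,m)=\pi\mathrm{Hom}(K_{m-1},I(k,m))$,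 $\mathsf D_+(k,m)=\pi\mathrm{Hom}_+(K_{m-1},I(k,m))$ are the families of projected cells. Staircase triangulation: a lattice path in $[r]\times[s]$ is a connected chain of horizontal and vertical unit segments joining $(1,1)$ to $(r,s)$, weakly monotone in both coordinates, identified with its vertex set; partial lattice paths are subsets of lattice paths. Identifying $(i,j)$ with the vertex $(e_i,e_j)$ of $\Delta^{r-1}\times\Delta^{s-1}\subset\mathbb R^r\times\mathbb R^s$, the partial lattice paths index the simplices of the staircase triangulation $\Sigma(r,s)$. $\mathcal C(r,s)$ is the polytopal complex whose cells are the non-empty intersections of simplices of $\Sigma(r,s)$ with the plane $\{(\frac1r,\dots,\frac1r)\}\times\mathbb R^s$. A "copy" of a complex is a subcomplex isomorphic to it (isomorphism of face posets).
   Formalization: The case k=3, m=1 is excluded: there δ(3,1) is empty, D_+(3,1) has only the empty simplex and so contains no copy of Σ(1,1), and the factor 1/(m−1) in the definition of D(3,1) is undefined. -}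

module Defs where

open import Level using (Level; _⊔_) renaming (zero to 0ℓ; suc to lsuc)
open import Algebra.Bundles using (CommutativeRing)
open import Algebra.Structures using (IsCommutativeRing)
open import Algebra.Definitions.RawMonoid using (sum) renaming (_×_ to multiple)
open import Data.Nat.Base as ℕ using (ℕ; suc; _∸_)
open import Data.Fin.Base as Fin using (Fin; toℕ)
open import Data.Fin.Properties using () renaming (_≟_ to _≟ᶠ_)
open import Data.List.Base using (List; []; _∷_; [_]; _++_; length; lookup; concat; tabulate; allFin)
open import Data.List.Membership.Propositional using (_∈_)
open import Data.List.Relation.Binary.Subset.Propositional using () renaming (_⊆_ to _⊆ᴸ_)
open import Data.Product.Base using (Σ; ∃; Σ-syntax; ∃-syntax; _×_; _,_; proj₁; proj₂)
open import Data.Product.Properties using (≡-dec)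
open import Data.Refinement using (Refinement-syntax; value) renaming (_≟_ to refinement-≟)
open import Data.Sum.Base using (_⊎_; inj₁; inj₂; swap)
open import Function.Base using (_∘_; _on_)
open import Relation.Binary.Core using (Rel)
open import Relation.Binary.Definitions using (DecidableEquality; Irreflexive; Symmetric)
open import Relation.Binary.Morphism.Structures using (IsOrderIsomorphism)
open import Relation.Binary.PropositionalEquality.Core using (_≡_; _≢_; _≗_; refl; sym)
open import Relation.Binary.Structures using (IsDecTotalOrder)
open import Relation.Nullary.Decidable.Core using (does)
open import Relation.Nullary.Negation.Core using (¬_)
open import Relation.Unary using (Pred; Satisfiable; _∩_; _⊆_; _≐_)
open import Data.Bool.Base using (if_then_else_)

-- The library has no real numbers; polytopes live over an arbitrary linearly
-- ordered field, of which ℝ (classically) and ℚ are instances.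
record OrderedField c ℓ : Set (lsuc (c ⊔ ℓ)) where
  infixl 6 _+_
  infixl 7 _*_
  infix  8 -_
  infix  9 _⁻¹
  infix  4 _≤_
  field
    Carrier           : Set c
    _+_ _*_           : Carrier → Carrier → Carrier
    -_ _⁻¹            : Carrier → Carrier
    0# 1#             : Carrier
    _≤_               : Rel Carrier ℓ
    isCommutativeRing : IsCommutativeRing _≡_ _+_ _*_ -_ 0# 1#
    0≢1               : 0# ≢ 1#
    -- _⁻¹ is total for convenience; its value at 0# is unconstrained.
    *-inverseʳ        : ∀ x → x ≢ 0# → x * x ⁻¹ ≡ 1#
    isDecTotalOrder   : IsDecTotalOrder _≡_ _≤_
    +-monoˡ-≤         : ∀ z {x y} → x ≤ y → x + z ≤ y + z
    *-nonNegative     : ∀ {x y} → 0# ≤ x → 0# ≤ y → 0# ≤ x * y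

  commutativeRing : CommutativeRing c c
  commutativeRing = record { isCommutativeRing = isCommutativeRing }

  ∑ : ∀ {n} → (Fin n → Carrier) → Carrier
  ∑ = sum (CommutativeRing.+-rawMonoid commutativeRing)

  fromℕ : ℕ → Carrier
  fromℕ n = multiple (CommutativeRing.+-rawMonoid commutativeRing) n 1#

------------------------------------------------------------------------
-- Convex geometry in the coordinate space K^I

module Convex {c ℓ} (K : OrderedField c ℓ) where
  open OrderedField K

  Point : Set → Set c
  Point I = I → Carrier

  Region : Set → Set (lsuc (c ⊔ ℓ))
  Region I = Pred (Point I) (c ⊔ ℓ)

  unit : ∀ {I} → DecidableEquality I → I → Point I
  unit _≟_ i j = if does (i ≟ j) then 1# else 0#

  Conv : ∀ {I n} → (Fin n → Point I) → Region I
  Conv {n = n} p x = Σ[ w ∈ (Fin n → Carrier) ]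
      (∀ i → 0# ≤ w i)
    × ∑ w ≡ 1#
    × (∀ a → x a ≡ ∑ λ i → w i * p i a)

  Minkowski : ∀ {I n} → (Fin n → Region I) → Region I
  Minkowski {I} {n} P x = Σ[ y ∈ (Fin n → Point I) ]
      (∀ i → P i (y i))
    × (∀ a → x a ≡ ∑ λ i → y i a)

  infixr 7 _·_
  _·_ : ∀ {I} → Carrier → Region I → Region I
  (t · P) x = ∃ λ y → P y × (∀ a → x a ≡ t * y a)

  record LinearFunctional (I : Set) : Set c where
    field
      apply       : Point I → Carrier
      cong        : ∀ {x y} → x ≗ y → apply x ≡ apply y
      additive    : ∀ x y → apply (λ a → x a + y a) ≡ apply x + apply y
      homogeneous : ∀ t x → apply (λ a → t * x a) ≡ t * apply x
  open LinearFunctional public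

  -- The face of P in direction φ; every non-empty face of a polytope,
  -- including the polytope itself (φ = 0), is of this form.
  face : ∀ {I} → LinearFunctional I → Region I → Region I
  face φ P x = P x × (∀ y → P y → apply φ y ≤ apply φ x)

  _IsFaceOf_ : ∀ {I} → Region I → Region I → Set (c ⊔ ℓ)
  F IsFaceOf P = ∃[ φ ] F ≐ face φ P

  -- A family of cells is a set of point sets: two indices with extensionally
  -- equal regions denote the same cell.
  record Family (I : Set) : Set (lsuc (c ⊔ ℓ)) where
    field
      Index : Set (c ⊔ ℓ)
      cell  : Index → Region I
  open Family public

  restrict : ∀ {I} (F : Family I) → Pred (Index F) (c ⊔ ℓ) → Family I
  restrict F S .Index = Σ (Index F) S
  restrict F S .cell  = cell F ∘ proj₁

  -- The empty cell may or may not belong to the family.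
  record IsPolytopalComplex {I} (F : Family I) : Set (c ⊔ ℓ) where
    field
      face-closed  : ∀ i φ → Satisfiable (face φ (cell F i)) →
                     ∃[ j ] cell F j ≐ face φ (cell F i)
      intersection : ∀ i j → Satisfiable (cell F i ∩ cell F j) →
                       (cell F i ∩ cell F j) IsFaceOf cell F i
                     × (cell F i ∩ cell F j) IsFaceOf cell F j

  -- Face posets are the sets of cells ordered by inclusion.
  record _≅_ {I J} (F : Family I) (G : Family J) : Set (c ⊔ ℓ) where
    field
      to                 : Index F → Index G
      isOrderIsomorphism : IsOrderIsomorphism
                             (_≐_ on cell F) (_≐_ on cell G)
                             (_⊆_ on cell F) (_⊆_ on cell G) to

  record _ContainsCopyOf_ {I J} (F : Family I) (G : Family J) : Set (lsuc (c ⊔ ℓ)) where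
    field
      subfamily  : Pred (Index F) (c ⊔ ℓ)
      subcomplex : IsPolytopalComplex (restrict F subfamily)
      isomorphic : G ≅ restrict F subfamily

------------------------------------------------------------------------
-- Hom complexes of complete graphs and their canonical projections

record Graph : Set₁ where
  infix 4 _≟_
  field
    V        : Set
    _≟_      : DecidableEquality V
    Adj      : Rel V 0ℓ
    sym-Adj  : Symmetric Adj
    loopless : Irreflexive _≡_ Adj

module _ (g : ℕ) (H : Graph) where
  open Graph H

  -- Subsets of V(H) are given by lists, of which order and repetitions are
  -- invisible to the projected cells.  Membership in an empty list being
  -- impossible, the condition concerns only pairs of non-empty σᵢ, σⱼ.
  record Hom₊Simplex : Set where
    field
      σ          : Fin g → List V
      compatible : ∀ {i j} → i ≢ j → ∀ {u v} → u ∈ σ i → v ∈ σ j → Adj u v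

  record HomCell : Set where
    field
      simplex  : Hom₊Simplex
      nonEmpty : ∀ i → Hom₊Simplex.σ simplex i ≢ []
    open Hom₊Simplex simplex public

module Projection {c ℓ} (K : OrderedField c ℓ) (g : ℕ) (H : Graph) where
  open OrderedField K using (_⁻¹; fromℕ)
  open Convex K
  open Graph H
  open Level using (Lift; lower)

  simplexOn : List V → Region V
  simplexOn σ = Conv (unit _≟_ ∘ lookup σ)

  πHom : Family V
  πHom .Index  = Lift (c ⊔ ℓ) (HomCell g H)
  πHom .cell τ = fromℕ g ⁻¹ · Minkowski (simplexOn ∘ HomCell.σ (lower τ))

  πHom₊ : Family V
  πHom₊ .Index  = Lift (c ⊔ ℓ) (Hom₊Simplex g H)
  πHom₊ .cell τ = simplexOn (concat (tabulate (Hom₊Simplex.σ (lower τ))))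

------------------------------------------------------------------------
-- Dissections of a convex polygon

-- `Dissection k P m D`: the diagonals D dissect the convex polygon with vertices
-- P, listed in cyclic order, into m k-gons.  A diagonal ab cuts P into the
-- polygon between a and b and the remaining polygon.  For k ≥ 3 all polygons
-- that occur have at least three vertices, so a and b are never adjacent in P.
data Dissection {V : Set} (k : ℕ) : List V → ℕ → List (V × V) → Set where
  whole : ∀ {P} → length P ≡ k → Dissection k P 1 []
  cut   : ∀ xs {a} ys {b} zs {m₁ m₂ D₁ D₂} →
          Dissection k (a ∷ ys ++ [ b ]) m₁ D₁ →
          Dissection k (xs ++ a ∷ b ∷ zs) m₂ D₂ →
          Dissection k (xs ++ a ∷ ys ++ b ∷ zs) (m₁ ℕ.+ m₂) ((a , b) ∷ D₁ ++ D₂)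

vertexCount : ℕ → ℕ → ℕ
vertexCount k m = m ℕ.* (k ∸ 2) ℕ.+ 2

-- Diagonals produced by dissections of `allFin N` have their smaller end first.
Chord : ℕ → ℕ → Set
Chord k m = Fin (vertexCount k m) × Fin (vertexCount k m)

Allowable : ∀ k m → Chord k m → Set
Allowable k m d = ∃[ D ] Dissection k (allFin (vertexCount k m)) m D × d ∈ D

δ : ℕ → ℕ → Set
δ k m = [ d ∈ Chord k m ∣ Allowable k m d ]

-- Distinct diagonals of a convex polygon meet in their relative interiors
-- exactly when their ends alternate around the polygon.
Alternate : ∀ {n} → Rel (Fin n × Fin n) 0ℓ
Alternate (a , b) (c , d) = a Fin.< c × c Fin.< b × b Fin.< d

Crossing : ∀ {n} → Rel (Fin n × Fin n) 0ℓ
Crossing d e = Alternate d e ⊎ Alternate e d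

I : ℕ → ℕ → Graph
I k m = record
  { V        = δ k m
  ; _≟_      = refinement-≟ (≡-dec _≟ᶠ_ _≟ᶠ_)
  ; Adj      = λ d e → d ≢ e × ¬ Crossing (value d) (value e)
  ; sym-Adj  = λ (d≢e , nc) → (d≢e ∘ sym) , (nc ∘ swap)
  ; loopless = λ d≡e adj → proj₁ adj d≡e
  }

module _ {c ℓ} (K : OrderedField c ℓ) where
  open Convex K

  𝖣 𝖣₊ : ∀ k m → Family (δ k m)
  𝖣  k m = Projection.πHom  K (m ∸ 1) (I k m)
  𝖣₊ k m = Projection.πHom₊ K (m ∸ 1) (I k m)

------------------------------------------------------------------------
-- Staircase triangulations

module _ {r s : ℕ} where

  -- Vertex lists of monotone unit-step chains from (i , j) to the last corner.
  data ChainFrom : Fin r → Fin s → List (Fin r × Fin s) → Set where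
    end   : ∀ {i j} → suc (toℕ i) ≡ r → suc (toℕ j) ≡ s → ChainFrom i j [ (i , j) ]
    step₁ : ∀ {i i′ j L} → toℕ i′ ≡ suc (toℕ i) → ChainFrom i′ j L → ChainFrom i j ((i , j) ∷ L)
    step₂ : ∀ {i j j′ L} → toℕ j′ ≡ suc (toℕ j) → ChainFrom i j′ L → ChainFrom i j ((i , j) ∷ L)

  LatticePath : List (Fin r × Fin s) → Set
  LatticePath L = ∃[ i ] ∃[ j ] toℕ i ≡ 0 × toℕ j ≡ 0 × ChainFrom i j L

PartialPath : ℕ → ℕ → Set
PartialPath r s = Σ[ L ∈ List (Fin r × Fin s) ] ∃[ M ] LatticePath M × L ⊆ᴸ M

module _ {c ℓ} (K : OrderedField c ℓ) (r s : ℕ) where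
  open OrderedField K
  open Convex K
  open Level using (Lift; lower)

  -- The vertex (eᵢ , eⱼ) of the product, in K^r × K^s = K^(r ⊎ s).
  productVertex : Fin r × Fin s → Point (Fin r ⊎ Fin s)
  productVertex (i , j) (inj₁ a) = unit _≟ᶠ_ i a
  productVertex (i , j) (inj₂ b) = unit _≟ᶠ_ j b

  staircase : Family (Fin r ⊎ Fin s)
  staircase .Index  = Lift (c ⊔ ℓ) (PartialPath r s)
  staircase .cell L = Conv (productVertex ∘ lookup (proj₁ (lower L)))

  plane : Region (Fin r ⊎ Fin s)
  plane x = Lift (c ⊔ ℓ) (∀ i → x (inj₁ i) ≡ fromℕ r ⁻¹)

  𝒞 : Family (Fin r ⊎ Fin s)
  𝒞 .Index = Σ[ L ∈ Index staircase ] Satisfiable (cell staircase L ∩ plane)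
  𝒞 .cell (L , _) = cell staircase L ∩ plane

{-# OPTIONS --safe #-}

-- For i < m − 1 and j < s put d(i,j) = (j , j + (m − 1 − i)(k − 2) + 1).  Since
-- s ≤ k − 1, d(i,j) ends no earlier than d(i′,j′) when i < i′, so the two do not
-- cross when moreover j ≤ j′.  Hence the rows of a lattice path are the sets σᵢ of
-- a simplex of Hom₊(K_{m−1}, I(k,m)).  The bound on r gives r ≤ m − 1; for Hom the
-- rows from r on are filled with their last diagonal, which does not cross the
-- diagonals of any earlier row.  The image of the partial paths is closed under
-- faces and intersections, and on both sides a cell is contained in another if and
-- only if this holds for the underlying partial paths: for 𝒞(r,s) because the
-- weights of a point on a lattice path are determined by its coordinates.
module Submission where

open import Defs
open import Algebra.Bundles using (CommutativeRing)
open import Data.Bool.Base using (true; false; if_then_else_)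
open import Data.Empty using (⊥-elim)
open import Data.Fin.Base as Fin using (Fin; zero; suc; toℕ; fromℕ<; inject≤)
open import Data.Fin.Properties
  using (any?; toℕ-injective; toℕ-inject≤; toℕ<n; inject≤-injective; toℕ-fromℕ<; ≤fromℕ)
  renaming (_≟_ to _≟ᶠ_)
import Data.Irrelevant as Irrelevant
open import Data.List.Base
  using (List; []; _∷_; [_]; _++_; length; lookup; filter; map; concat; tabulate; allFin)
open import Data.List.Membership.Propositional using (_∈_; _∉_)
open import Data.List.Membership.Propositional.Properties
  using ( ∈-lookup; ∈-filter⁺; ∈-filter⁻; ∈-map⁺; ∈-map⁻; ∈-++⁺ˡ; ∈-++⁺ʳ; ∈-++⁻
        ; ∈-allFin; ∈-concat⁺′; ∈-concat⁻′; ∈-tabulate⁺; ∈-tabulate⁻)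
import Data.List.Membership.DecPropositional as DecMembership
open import Data.List.Properties using (length-++; length-tabulate)
open import Data.List.Relation.Binary.Subset.Propositional using () renaming (_⊆_ to _⊆ᴸ_)
open import Data.List.Relation.Unary.Any using (here; there; index)
open import Data.List.Relation.Unary.Any.Properties using (lookup-index)
open import Data.Nat.Base as ℕ using (ℕ; s≤s)
open import Data.Nat.Properties as ℕ using (_<?_; _≤?_)
open import Data.Nat.Tactic.RingSolver using (solve-∀)
open import Data.Product.Base using (∃-syntax; _×_; _,_; proj₁; proj₂; swap)
open import Data.Product.Properties using (≡-dec)
open import Data.Refinement using (value; _,_)
open import Data.Sum.Base using (_⊎_; inj₁; inj₂; map₂)
open import Function.Base using (_∘_)
open import Level using (lift; lower)
open import Relation.Binary.Definitions using (DecidableEquality; tri<; tri≈; tri>)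
open import Relation.Binary.PropositionalEquality
  using (_≡_; _≢_; refl; sym; trans; cong; cong₂; subst; subst₂; module ≡-Reasoning)
open import Relation.Binary.Structures using (IsDecTotalOrder)
open import Relation.Nullary.Decidable using (Dec; yes; no; does; _×-dec_; ¬?; dec-true; dec-false)
open import Relation.Nullary.Negation.Core using (¬_)
open import Relation.Unary using (Satisfiable; _∩_; _⊆_; _≐_)

-- The staircase side is the delicate one. Projected cells are spanned by distinct unit vectors, or
-- are averages of such simplices, so supports can be read off from coordinates; but the vertices
-- (eᵢ , eⱼ) of the product are affinely dependent, with a relation for every rectangle of the grid.
-- Uniqueness of weights is a transport argument: among all distributions of mass with given row and
-- column sums, a non-crossing one has the largest mass in every corner [0,α) × [0,β). Two
-- non-crossing ones therefore agree on all corners, hence on every grid point. Inclusion of slices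
-- is tested on barycentres of sections, which take one point from each row, since the vertices of a
-- cell of Σ(r,s) in general miss the plane. The bound on r leaves exactly one gap: for k = 3 and m
-- = 1 it admits r = 1 although m - 1 = 0. Then `𝖣₊` has only the empty cell, while Σ(1,s) has
-- vertices; hence the excluded case.

-- Arithmetic and finite sums in an ordered field.

module OrderedFieldProperties {c ℓ} (K : OrderedField c ℓ) where
  open OrderedField K
  open CommutativeRing commutativeRing public
    using ( +-assoc; +-comm; +-identityˡ; +-identityʳ; -‿inverseʳ; -‿inverseˡ
          ; *-assoc; *-comm; *-identityˡ; *-identityʳ; distribˡ; distribʳ; zeroˡ; zeroʳ; ring; semiring)
  open import Algebra.Properties.Ring ring public
    using (-‿distribˡ-*; -‿distribʳ-*; -‿involutive; -0#≈0#; -‿+-comm; +-cancelˡ; +-cancelʳ)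
  open import Algebra.Properties.Semiring.Sum semiring public
    using (∑-distrib-+; ∑-comm; *-distribˡ-sum; *-distribʳ-sum; sum-replicate-zero)
    renaming (sum-cong-≗ to ∑-cong)
  open IsDecTotalOrder isDecTotalOrder public
    using (_≟_)
    renaming (refl to ≤-refl; reflexive to ≤-reflexive; trans to ≤-trans; antisym to ≤-antisym; total to ≤-total)
  open ≡-Reasoning

  +-mono-≤ : ∀ {x y u v} → x ≤ y → u ≤ v → x + u ≤ y + v
  +-mono-≤ {x} {y} {u} {v} x≤y u≤v =
    ≤-trans (+-monoˡ-≤ u x≤y) (subst₂ _≤_ (+-comm u y) (+-comm v y) (+-monoˡ-≤ y u≤v))

  +-nonNegative : ∀ {x y} → 0# ≤ x → 0# ≤ y → 0# ≤ x + y
  +-nonNegative 0≤x 0≤y = subst (_≤ _) (+-identityˡ 0#) (+-mono-≤ 0≤x 0≤y)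

  x≤y⇒0≤y-x : ∀ {x y} → x ≤ y → 0# ≤ y + - x
  x≤y⇒0≤y-x {x} x≤y = subst (_≤ _) (-‿inverseʳ x) (+-monoˡ-≤ (- x) x≤y)

  0≤y-x⇒x≤y : ∀ {x y} → 0# ≤ y + - x → x ≤ y
  0≤y-x⇒x≤y {x} {y} 0≤y-x = subst₂ _≤_ (+-identityˡ x)
    (trans (+-assoc y (- x) x) (trans (cong (y +_) (-‿inverseˡ x)) (+-identityʳ y))) (+-monoˡ-≤ x 0≤y-x)

  x≤0⇒0≤-x : ∀ {x} → x ≤ 0# → 0# ≤ - x
  x≤0⇒0≤-x {x} x≤0 = subst (0# ≤_) (+-identityˡ (- x)) (x≤y⇒0≤y-x x≤0)

  0≤x⇒-x≤0 : ∀ {x} → 0# ≤ x → - x ≤ 0#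
  0≤x⇒-x≤0 {x} 0≤x = subst₂ _≤_ (+-identityˡ (- x)) (-‿inverseʳ x) (+-monoˡ-≤ (- x) 0≤x)

  0≤1 : 0# ≤ 1#
  0≤1 with ≤-total 0# 1#
  ... | inj₁ 0≤1 = 0≤1
  ... | inj₂ 1≤0 = subst (0# ≤_) eq (*-nonNegative (x≤0⇒0≤-x 1≤0) (x≤0⇒0≤-x 1≤0))
    where
    eq : - 1# * - 1# ≡ 1#
    eq = trans (sym (-‿distribˡ-* 1# (- 1#))) (trans (cong -_ (*-identityˡ (- 1#))) (-‿involutive 1#))

  1≢0 : 1# ≢ 0#
  1≢0 = 0≢1 ∘ sym

  *-monoˡ-≤ : ∀ {t x y} → 0# ≤ t → x ≤ y → t * x ≤ t * y
  *-monoˡ-≤ {t} {x} {y} 0≤t x≤y = 0≤y-x⇒x≤y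
    (subst (0# ≤_) (trans (distribˡ t y (- x)) (cong (t * y +_) (sym (-‿distribʳ-* t x))))
      (*-nonNegative 0≤t (x≤y⇒0≤y-x x≤y)))

  ⁻¹*-cancel : ∀ {t} x → t ≢ 0# → t ⁻¹ * (t * x) ≡ x
  ⁻¹*-cancel {t} x t≢0 = begin
    t ⁻¹ * (t * x)  ≡⟨ *-assoc _ _ _ ⟨
    t ⁻¹ * t * x    ≡⟨ cong (_* x) (trans (*-comm _ _) (*-inverseʳ t t≢0)) ⟩
    1# * x          ≡⟨ *-identityˡ x ⟩
    x               ∎

  *-zero-cancelˡ : ∀ {t x} → t ≢ 0# → t * x ≡ 0# → x ≡ 0#
  *-zero-cancelˡ {t} {x} t≢0 tx≡0 =
    trans (sym (⁻¹*-cancel x t≢0)) (trans (cong (t ⁻¹ *_) tx≡0) (zeroʳ _))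

  *-zero-split : ∀ {x y} → x * y ≡ 0# → x ≡ 0# ⊎ y ≡ 0#
  *-zero-split {x} xy≡0 with x ≟ 0#
  ... | yes x≡0 = inj₁ x≡0
  ... | no  x≢0 = inj₂ (*-zero-cancelˡ x≢0 xy≡0)

  ⁻¹-nonZero : ∀ {x} → x ≢ 0# → x ⁻¹ ≢ 0#
  ⁻¹-nonZero {x} x≢0 x⁻¹≡0 = 0≢1 (trans (sym (zeroʳ x)) (trans (cong (x *_) (sym x⁻¹≡0)) (*-inverseʳ x x≢0)))

  ⁻¹-nonNegative : ∀ {x} → 0# ≤ x → x ≢ 0# → 0# ≤ x ⁻¹
  ⁻¹-nonNegative {x} 0≤x x≢0 with ≤-total 0# (x ⁻¹)
  ... | inj₁ 0≤x⁻¹ = 0≤x⁻¹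
  ... | inj₂ x⁻¹≤0 = ⊥-elim (0≢1 (≤-antisym 0≤1
    (subst₂ _≤_ (*-inverseʳ x x≢0) (zeroʳ x) (*-monoˡ-≤ 0≤x x⁻¹≤0))))

  *-cancelˡ-≤ : ∀ {t x y} → 0# ≤ t → t ≢ 0# → t * x ≤ t * y → x ≤ y
  *-cancelˡ-≤ 0≤t t≢0 tx≤ty =
    subst₂ _≤_ (⁻¹*-cancel _ t≢0) (⁻¹*-cancel _ t≢0) (*-monoˡ-≤ (⁻¹-nonNegative 0≤t t≢0) tx≤ty)

  ∑-nonNegative : ∀ {n} (f : Fin n → Carrier) → (∀ i → 0# ≤ f i) → 0# ≤ ∑ f
  ∑-nonNegative {ℕ.zero}  f 0≤f = ≤-refl
  ∑-nonNegative {ℕ.suc n} f 0≤f = +-nonNegative (0≤f zero) (∑-nonNegative (f ∘ suc) (0≤f ∘ suc))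

  ∑-mono-≤ : ∀ {n} (f g : Fin n → Carrier) → (∀ i → f i ≤ g i) → ∑ f ≤ ∑ g
  ∑-mono-≤ {ℕ.zero}  f g f≤g = ≤-refl
  ∑-mono-≤ {ℕ.suc n} f g f≤g = +-mono-≤ (f≤g zero) (∑-mono-≤ (f ∘ suc) (g ∘ suc) (f≤g ∘ suc))

  ∑-zero : ∀ {n} (f : Fin n → Carrier) → (∀ i → f i ≡ 0#) → ∑ f ≡ 0#
  ∑-zero {n} f f≡0 = trans (∑-cong f≡0) (sum-replicate-zero n)

  +-zero-nonNegative : ∀ {x y} → 0# ≤ x → 0# ≤ y → x + y ≡ 0# → x ≡ 0#
  +-zero-nonNegative {x} {y} 0≤x 0≤y x+y≡0 = ≤-antisym
    (subst₂ _≤_ (+-identityʳ x) x+y≡0 (+-mono-≤ ≤-refl 0≤y)) 0≤x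

  ∑-zero⇒zero : ∀ {n} (f : Fin n → Carrier) → (∀ i → 0# ≤ f i) → ∑ f ≡ 0# → ∀ i → f i ≡ 0#
  ∑-zero⇒zero {ℕ.suc n} f 0≤f ∑≡0 zero    =
    +-zero-nonNegative (0≤f zero) (∑-nonNegative (f ∘ suc) (0≤f ∘ suc)) ∑≡0
  ∑-zero⇒zero {ℕ.suc n} f 0≤f ∑≡0 (suc i) = ∑-zero⇒zero (f ∘ suc) (0≤f ∘ suc)
    (+-zero-nonNegative (∑-nonNegative (f ∘ suc) (0≤f ∘ suc)) (0≤f zero) (trans (+-comm _ _) ∑≡0)) i

  ∑-nonZero⇒∃ : ∀ {n} (f : Fin n → Carrier) → ∑ f ≢ 0# → ∃[ i ] f i ≢ 0#
  ∑-nonZero⇒∃ {ℕ.zero}  f ∑≢0 = ⊥-elim (∑≢0 refl)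
  ∑-nonZero⇒∃ {ℕ.suc n} f ∑≢0 with f zero ≟ 0#
  ... | no  f0≢0 = zero , f0≢0
  ... | yes f0≡0 with i , fi≢0 ← ∑-nonZero⇒∃ (f ∘ suc)
                        (λ ∑≡0 → ∑≢0 (trans (cong₂ _+_ f0≡0 ∑≡0) (+-identityˡ 0#))) = suc i , fi≢0

  fromℕ-nonNegative : ∀ n → 0# ≤ fromℕ n
  fromℕ-nonNegative ℕ.zero    = ≤-refl
  fromℕ-nonNegative (ℕ.suc n) = +-nonNegative 0≤1 (fromℕ-nonNegative n)

  fromℕ-nonZero : ∀ {n} → n ≢ 0 → fromℕ n ≢ 0#
  fromℕ-nonZero {ℕ.zero}  n≢0 = ⊥-elim (n≢0 refl)
  fromℕ-nonZero {ℕ.suc n} _   = 1≢0 ∘ +-zero-nonNegative 0≤1 (fromℕ-nonNegative n)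

  ∑-const : ∀ n x → ∑ {n} (λ _ → x) ≡ fromℕ n * x
  ∑-const ℕ.zero    x = sym (zeroˡ x)
  ∑-const (ℕ.suc n) x = begin
    x + ∑ {n} (λ _ → x)      ≡⟨ cong₂ _+_ (sym (*-identityˡ x)) (∑-const n x) ⟩
    1# * x + fromℕ n * x     ≡⟨ distribʳ x 1# (fromℕ n) ⟨
    (1# + fromℕ n) * x       ∎

  ∑-unit : ∀ {n} (i : Fin n) (f : Fin n → Carrier) → ∑ (λ k → Convex.unit K _≟ᶠ_ i k * f k) ≡ f i
  ∑-unit {ℕ.suc n} zero    f = trans (cong₂ _+_ (*-identityˡ (f zero)) (∑-zero {n} _ (λ k → zeroˡ (f (suc k))))) (+-identityʳ _)
  ∑-unit {ℕ.suc n} (suc i) f = trans (cong₂ _+_ (zeroˡ (f zero)) (∑-unit i (f ∘ suc))) (+-identityˡ _)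

-- Convex hulls, Minkowski sums and their faces.

module ConvexProperties {c ℓ} (K : OrderedField c ℓ) where
  open OrderedField K
  open OrderedFieldProperties K
  open Convex K hiding (cong)
  open ≡-Reasoning

  unit-diagonal : ∀ {I} (_≟ᴵ_ : DecidableEquality I) i → unit _≟ᴵ_ i i ≡ 1#
  unit-diagonal _≟ᴵ_ i with i ≟ᴵ i
  ... | yes _   = refl
  ... | no  i≢i = ⊥-elim (i≢i refl)

  unit-nonZero : ∀ {I} (_≟ᴵ_ : DecidableEquality I) {i j} → unit _≟ᴵ_ i j ≢ 0# → i ≡ j
  unit-nonZero _≟ᴵ_ {i} {j} ≢0 with i ≟ᴵ j
  ... | yes i≡j = i≡j
  ... | no  _   = ⊥-elim (≢0 refl)

  unit-nonNegative : ∀ {I} (_≟ᴵ_ : DecidableEquality I) i j → 0# ≤ unit _≟ᴵ_ i j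
  unit-nonNegative _≟ᴵ_ i j with does (i ≟ᴵ j)
  ... | true  = 0≤1
  ... | false = ≤-refl

  module _ {I : Set} {n m : ℕ} {p : Fin n → Point I} {q : Fin m → Point I} where

    -- Compose the weights and interchange the sums. Points of weight zero may lie anywhere; this is
    -- how a hull is later shrunk to the vertices that carry weight.
    Conv-mix : ∀ {x} ((w , _) : Conv p x) → (∀ i → w i ≡ 0# ⊎ Conv q (p i)) → Conv q x
    Conv-mix {x} (w , 0≤w , ∑w≡1 , x≡) h = (λ k → ∑ λ i → u i k) , nonNeg , total , point
      where
      scaled : ∀ i → ∃[ u ] (∀ k → 0# ≤ u k) × ∑ u ≡ w i × (∀ a → ∑ (λ k → u k * q k a) ≡ w i * p i a)
      scaled i with h i
      ... | inj₁ wi≡0 = (λ _ → 0#) , (λ _ → ≤-refl) , trans (∑-zero {m} _ (λ _ → refl)) (sym wi≡0) ,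
        λ a → trans (∑-zero {m} _ (λ k → zeroˡ (q k a))) (sym (trans (cong (_* p i a) wi≡0) (zeroˡ _)))
      ... | inj₂ (v , 0≤v , ∑v≡1 , pi≡) = (λ k → w i * v k) , (λ k → *-nonNegative (0≤w i) (0≤v k)) ,
        trans (sym (*-distribˡ-sum (w i) v)) (trans (cong (w i *_) ∑v≡1) (*-identityʳ _)) ,
        λ a → begin
          ∑ (λ k → w i * v k * q k a)    ≡⟨ ∑-cong (λ k → *-assoc (w i) (v k) (q k a)) ⟩
          ∑ (λ k → w i * (v k * q k a))  ≡⟨ *-distribˡ-sum (w i) (λ k → v k * q k a) ⟨
          w i * ∑ (λ k → v k * q k a)    ≡⟨ cong (w i *_) (pi≡ a) ⟨
          w i * p i a                    ∎
      u : Fin n → Fin m → Carrier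
      u i = proj₁ (scaled i)
      nonNeg : ∀ k → 0# ≤ ∑ (λ i → u i k)
      nonNeg k = ∑-nonNegative (λ i → u i k) (λ i → proj₁ (proj₂ (scaled i)) k)
      total : ∑ (λ k → ∑ λ i → u i k) ≡ 1#
      total = trans (∑-comm (λ k i → u i k)) (trans (∑-cong (λ i → proj₁ (proj₂ (proj₂ (scaled i))))) ∑w≡1)
      point : ∀ a → x a ≡ ∑ (λ k → ∑ (λ i → u i k) * q k a)
      point a = begin
        x a                                    ≡⟨ x≡ a ⟩
        ∑ (λ i → w i * p i a)                  ≡⟨ ∑-cong (λ i → proj₂ (proj₂ (proj₂ (scaled i))) a) ⟨
        ∑ (λ i → ∑ (λ k → u i k * q k a))      ≡⟨ ∑-comm (λ i k → u i k * q k a) ⟩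
        ∑ (λ k → ∑ (λ i → u i k * q k a))      ≡⟨ ∑-cong (λ k → *-distribʳ-sum (q k a) (λ i → u i k)) ⟨
        ∑ (λ k → ∑ (λ i → u i k) * q k a)      ∎

  vertex∈Conv : ∀ {I n} (p : Fin n → Point I) i → Conv p (p i)
  vertex∈Conv {n = n} p i = unit _≟ᶠ_ i , unit-nonNegative _≟ᶠ_ i ,
    trans (∑-cong {n} (λ k → sym (*-identityʳ (unit _≟ᶠ_ i k)))) (∑-unit i (λ _ → 1#)) ,
    λ a → sym (∑-unit i (λ k → p k a))

  apply-∑ : ∀ {I n} (φ : LinearFunctional I) (w : Fin n → Carrier) (p : Fin n → Point I) →
            apply φ (λ a → ∑ λ i → w i * p i a) ≡ ∑ λ i → w i * apply φ (p i)
  apply-∑ {n = ℕ.zero}  φ w p = begin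
    apply φ (λ _ → 0#)       ≡⟨ Convex.cong φ (λ _ → zeroˡ 0#) ⟨
    apply φ (λ _ → 0# * 0#)  ≡⟨ homogeneous φ 0# (λ _ → 0#) ⟩
    0# * apply φ (λ _ → 0#)  ≡⟨ zeroˡ _ ⟩
    0#                       ∎
  apply-∑ {n = ℕ.suc n} φ w p = begin
    apply φ (λ a → w zero * p zero a + ∑ λ i → w (suc i) * p (suc i) a)
      ≡⟨ additive φ (λ a → w zero * p zero a) (λ a → ∑ λ i → w (suc i) * p (suc i) a) ⟩
    apply φ (λ a → w zero * p zero a) + apply φ (λ a → ∑ λ i → w (suc i) * p (suc i) a)
      ≡⟨ cong₂ _+_ (homogeneous φ (w zero) (p zero)) (apply-∑ φ (w ∘ suc) (p ∘ suc)) ⟩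
    w zero * apply φ (p zero) + ∑ (λ i → w (suc i) * apply φ (p (suc i))) ∎

  -- The weighted gaps `w i * (φ x − φ (p i))` are non-negative and add up to φ x - φ x, so each of
  -- them vanishes.
  face-weights : ∀ {I n} {p : Fin n → Point I} φ {x} → (∀ i → apply φ (p i) ≤ apply φ x) →
                 ((w , _) : Conv p x) → ∀ i → w i ≡ 0# ⊎ apply φ (p i) ≡ apply φ x
  face-weights {p = p} φ {x} φp≤φx (w , 0≤w , ∑w≡1 , x≡) i with *-zero-split (gap≡0 i)
    where
    gap : Fin _ → Carrier
    gap i = w i * (apply φ x + - apply φ (p i))
    ∑gap≡0 : ∑ gap ≡ 0#
    ∑gap≡0 = begin
      ∑ gap
        ≡⟨ ∑-cong (λ i → trans (distribˡ (w i) (apply φ x) (- apply φ (p i)))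
             (cong (w i * apply φ x +_) (trans (sym (-‿distribʳ-* (w i) (apply φ (p i)))) (neg (w i * apply φ (p i)))))) ⟩
      ∑ (λ i → w i * apply φ x + - 1# * (w i * apply φ (p i)))
        ≡⟨ ∑-distrib-+ (λ i → w i * apply φ x) (λ i → - 1# * (w i * apply φ (p i))) ⟩
      ∑ (λ i → w i * apply φ x) + ∑ (λ i → - 1# * (w i * apply φ (p i)))
        ≡⟨ cong₂ _+_ (sym (*-distribʳ-sum (apply φ x) w)) (sym (*-distribˡ-sum (- 1#) (λ i → w i * apply φ (p i)))) ⟩
      ∑ w * apply φ x + - 1# * ∑ (λ i → w i * apply φ (p i))
        ≡⟨ cong₂ _+_ (trans (cong (_* apply φ x) ∑w≡1) (*-identityˡ _))
             (trans (sym (neg (∑ (λ i → w i * apply φ (p i)))))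
               (cong -_ (trans (sym (apply-∑ φ w p)) (sym (Convex.cong φ x≡))))) ⟩
      apply φ x + - apply φ x  ≡⟨ -‿inverseʳ _ ⟩
      0#                       ∎
      where
      neg : ∀ y → - y ≡ - 1# * y
      neg y = trans (cong -_ (sym (*-identityˡ y))) (-‿distribˡ-* 1# y)
    gap≡0 : ∀ i → gap i ≡ 0#
    gap≡0 = ∑-zero⇒zero gap (λ i → *-nonNegative (0≤w i) (x≤y⇒0≤y-x (φp≤φx i))) ∑gap≡0
  ... | inj₁ wi≡0 = inj₁ wi≡0
  ... | inj₂ d≡0  = inj₂ (sym (+-cancelʳ (- apply φ (p i)) _ _ (trans d≡0 (sym (-‿inverseʳ _)))))

  apply-Conv-const : ∀ {I n} {p : Fin n → Point I} φ {x μ} → (∀ i → apply φ (p i) ≡ μ) → Conv p x → apply φ x ≡ μ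
  apply-Conv-const {p = p} φ {x} {μ} φp≡μ (w , _ , ∑w≡1 , x≡) = begin
    apply φ x                        ≡⟨ Convex.cong φ x≡ ⟩
    apply φ (λ a → ∑ λ i → w i * p i a)    ≡⟨ apply-∑ φ w p ⟩
    ∑ (λ i → w i * apply φ (p i))    ≡⟨ ∑-cong (λ i → cong (w i *_) (φp≡μ i)) ⟩
    ∑ (λ i → w i * μ)                ≡⟨ *-distribʳ-sum μ w ⟨
    ∑ w * μ                          ≡⟨ cong (_* μ) ∑w≡1 ⟩
    1# * μ                           ≡⟨ *-identityˡ μ ⟩
    μ                                ∎

  module _ {A I : Set} (p : A → Point I) where

    hull : List A → Region I
    hull L = Conv (p ∘ lookup L)

    vertex∈hull : ∀ {v L} → v ∈ L → hull L (p v)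
    vertex∈hull {v} {L} v∈L = subst (hull L ∘ p) (sym (lookup-index v∈L)) (vertex∈Conv (p ∘ lookup L) (index v∈L))

    hull-support : ∀ {n} {v : Fin n → A} {L x} ((w , _) : Conv (p ∘ v) x) →
                   (∀ i → w i ≡ 0# ⊎ v i ∈ L) → hull L x
    hull-support x∈ h = Conv-mix x∈ (map₂ vertex∈hull ∘ h)

    hull-mono : ∀ {L M} → L ⊆ᴸ M → hull L ⊆ hull M
    hull-mono {L} L⊆M x∈ = hull-support {v = lookup L} x∈ (λ i → inj₂ (L⊆M (∈-lookup i)))

    hull-nonEmpty : ∀ {L x} → hull L x → ∃[ v ] v ∈ L
    hull-nonEmpty {L} (w , _ , ∑w≡1 , _) with i , _ ← ∑-nonZero⇒∃ w (1≢0 ∘ trans (sym ∑w≡1)) = lookup L i , ∈-lookup i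

    -- By `face-weights` a maximiser puts weight only on vertices of maximal value. The maximum is
    -- supplied by the given point `x₀` of the face, so no search for it is made.
    face-hull : ∀ {L} φ {x₀} → face φ (hull L) x₀ →
                hull (filter (λ v → apply φ (p v) ≟ apply φ x₀) L) ≐ face φ (hull L)
    face-hull {L} φ {x₀} (x₀∈ , max) = to , from
      where
      best? = λ v → apply φ (p v) ≟ apply φ x₀
      to : hull (filter best? L) ⊆ face φ (hull L)
      to {x} x∈ = hull-mono (proj₁ ∘ ∈-filter⁻ best? {xs = L}) x∈ , λ y y∈ → subst (apply φ y ≤_) (sym φx≡) (max y y∈)
        where
        φx≡ : apply φ x ≡ apply φ x₀
        φx≡ = apply-Conv-const φ (λ i → proj₂ (∈-filter⁻ best? {xs = L} (∈-lookup i))) x∈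
      from : face φ (hull L) ⊆ hull (filter best? L)
      from {x} (x∈ , maxₓ) = hull-support {v = lookup L} x∈ λ i → keep i (face-weights φ (λ i → maxₓ _ (vertex∈Conv _ i)) x∈ i)
        where
        keep : ∀ i → _ ⊎ apply φ (p (lookup L i)) ≡ apply φ x → _ ⊎ lookup L i ∈ filter best? L
        keep i (inj₁ wi≡0) = inj₁ wi≡0
        keep i (inj₂ φ≡)   = inj₂ (∈-filter⁺ best? {xs = L} (∈-lookup i) (trans φ≡ (≤-antisym (max x x∈) (maxₓ x₀ x₀∈))))

  module _ {I : Set} {n : ℕ} {t} (0≤t : 0# ≤ t) (t≢0 : t ≢ 0#) where

    apply-scaled-∑ : (φ : LinearFunctional I) (y : Fin n → Point I) {x : Point I} {z : Point I} →
                     (∀ a → z a ≡ ∑ λ i → y i a) → (∀ a → x a ≡ t * z a) → apply φ x ≡ t * ∑ (λ i → apply φ (y i))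
    apply-scaled-∑ φ y {x} {z} z≡ x≡ = begin
      apply φ x                             ≡⟨ Convex.cong φ x≡ ⟩
      apply φ (λ a → t * z a)               ≡⟨ homogeneous φ t z ⟩
      t * apply φ z                         ≡⟨ cong (t *_) (Convex.cong φ (λ a → trans (z≡ a) (∑-cong (λ i → sym (*-identityˡ (y i a)))))) ⟩
      t * apply φ (λ a → ∑ λ i → 1# * y i a) ≡⟨ cong (t *_) (apply-∑ φ (λ _ → 1#) y) ⟩
      t * ∑ (λ i → 1# * apply φ (y i))      ≡⟨ cong (t *_) (∑-cong (λ i → *-identityˡ (apply φ (y i)))) ⟩
      t * ∑ (λ i → apply φ (y i))           ∎

    -- Replacing one summand of a maximiser shows that every summand is a maximiser.
    face-Minkowski : ∀ (φ : LinearFunctional I) (P : Fin n → Region I) →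
                     face φ (t · Minkowski P) ≐ (t · Minkowski (face φ ∘ P))
    face-Minkowski φ P = to , from
      where
      to : face φ (t · Minkowski P) ⊆ (t · Minkowski (face φ ∘ P))
      to {x} ((z , (y , y∈ , z≡) , x≡) , max) = z , (y , (λ i → y∈ i , best i) , z≡) , x≡
        where
        best : ∀ i v → P i v → apply φ v ≤ apply φ (y i)
        best i v v∈ = 0≤y-x⇒x≤y (subst (0# ≤_) diff (x≤y⇒0≤y-x sum≤))
          where
          y′ : Fin n → Point I
          y′ k = if does (i ≟ᶠ k) then v else y k
          y′∈ : ∀ k → P k (y′ k)
          y′∈ k with i ≟ᶠ k
          ... | yes refl = v∈
          ... | no _     = y∈ k
          z′ : Point I
          z′ a = ∑ λ k → y′ k a
          sum≤ : ∑ (λ k → apply φ (y′ k)) ≤ ∑ (λ k → apply φ (y k))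
          sum≤ = *-cancelˡ-≤ 0≤t t≢0 (subst₂ _≤_
            (apply-scaled-∑ φ y′ {z = z′} (λ _ → refl) (λ _ → refl)) (apply-scaled-∑ φ y z≡ x≡)
            (max _ (z′ , (y′ , y′∈ , λ _ → refl) , λ _ → refl)))
          -- A balance without subtraction: summing it over `k`, the unit factors isolate the one
          -- summand in which `y` and `y′` differ.
          split : ∀ k → apply φ (y k) + unit _≟ᶠ_ i k * apply φ v ≡ apply φ (y′ k) + unit _≟ᶠ_ i k * apply φ (y k)
          split k with i ≟ᶠ k
          ... | yes _ = trans (+-comm _ _) (cong₂ _+_ (*-identityˡ _) (sym (*-identityˡ _)))
          ... | no _  = cong (_ +_) (trans (zeroˡ _) (sym (zeroˡ _)))
          total : ∑ (λ k → apply φ (y k)) + apply φ v ≡ ∑ (λ k → apply φ (y′ k)) + apply φ (y i)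
          total = begin
            ∑ (λ k → apply φ (y k)) + apply φ v
              ≡⟨ cong (∑ (λ k → apply φ (y k)) +_) (∑-unit i (λ _ → apply φ v)) ⟨
            ∑ (λ k → apply φ (y k)) + ∑ (λ k → unit _≟ᶠ_ i k * apply φ v)
              ≡⟨ ∑-distrib-+ (λ k → apply φ (y k)) (λ k → unit _≟ᶠ_ i k * apply φ v) ⟨
            ∑ (λ k → apply φ (y k) + unit _≟ᶠ_ i k * apply φ v)
              ≡⟨ ∑-cong split ⟩
            ∑ (λ k → apply φ (y′ k) + unit _≟ᶠ_ i k * apply φ (y k))
              ≡⟨ ∑-distrib-+ (λ k → apply φ (y′ k)) (λ k → unit _≟ᶠ_ i k * apply φ (y k)) ⟩
            ∑ (λ k → apply φ (y′ k)) + ∑ (λ k → unit _≟ᶠ_ i k * apply φ (y k))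
              ≡⟨ cong (∑ (λ k → apply φ (y′ k)) +_) (∑-unit i (λ k → apply φ (y k))) ⟩
            ∑ (λ k → apply φ (y′ k)) + apply φ (y i) ∎
          diff : ∑ (λ k → apply φ (y k)) + - ∑ (λ k → apply φ (y′ k)) ≡ apply φ (y i) + - apply φ v
          diff = move total
            where
            move : ∀ {a b c d} → a + b ≡ c + d → a + - c ≡ d + - b
            move {a} {b} {c} {d} eq = +-cancelʳ b _ _ (begin
              a + - c + b        ≡⟨ +-assoc a (- c) b ⟩
              a + (- c + b)      ≡⟨ cong (a +_) (+-comm (- c) b) ⟩
              a + (b + - c)      ≡⟨ +-assoc a b (- c) ⟨
              a + b + - c        ≡⟨ cong (_+ - c) (trans eq (+-comm c d)) ⟩
              d + c + - c        ≡⟨ trans (+-assoc d c (- c)) (trans (cong (d +_) (-‿inverseʳ c)) (+-identityʳ d)) ⟩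
              d                  ≡⟨ trans (+-assoc d (- b) b) (trans (cong (d +_) (-‿inverseˡ b)) (+-identityʳ d)) ⟨
              d + - b + b        ∎)
      from : (t · Minkowski (face φ ∘ P)) ⊆ face φ (t · Minkowski P)
      from {x} (z , (y , y∈ , z≡) , x≡) = (z , (y , proj₁ ∘ y∈ , z≡) , x≡) ,
        λ { x′ (z′ , (y′ , y′∈ , z′≡) , x′≡) → subst₂ _≤_
              (sym (apply-scaled-∑ φ y′ z′≡ x′≡)) (sym (apply-scaled-∑ φ y z≡ x≡))
              (*-monoˡ-≤ 0≤t (∑-mono-≤ _ _ (λ i → proj₂ (y∈ i) (y′ i) (y′∈ i)))) }

  Minkowski-mono : ∀ {I n t} {P Q : Fin n → Region I} → (∀ i → P i ⊆ Q i) → (t · Minkowski P) ⊆ (t · Minkowski Q)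
  Minkowski-mono P⊆Q (z , (y , y∈ , z≡) , x≡) = z , (y , (λ i → P⊆Q i (y∈ i)) , z≡) , x≡

  -- On non-negative points its value is at most 0, with equality exactly when all coordinates in
  -- `B` vanish. It supports every intersection of cells below.
  -∑coordinates : ∀ {I} → List I → LinearFunctional I
  -∑coordinates B = record
    { apply       = λ x → - ∑ (x ∘ lookup B)
    ; cong        = λ x≗y → cong -_ (∑-cong (x≗y ∘ lookup B))
    ; additive    = λ x y → trans (cong -_ (∑-distrib-+ (x ∘ lookup B) (y ∘ lookup B))) (sym (-‿+-comm _ _))
    ; homogeneous = λ t x → trans (cong -_ (sym (*-distribˡ-sum t (x ∘ lookup B)))) (-‿distribʳ-* t _)
    }

  -- Within `P` the set `Q` is described by the vanishing of non-negative coordinates, hence by one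
  -- supporting hyperplane. The common point is needed to know that the maximum 0 is attained.
  ∩-isFaceOf : ∀ {I} {P Q : Region I} (B : List I) →
               (∀ {x} → P x → ∀ a → 0# ≤ x a) →
               (∀ {x} → P x → (∀ {a} → a ∈ B → x a ≡ 0#) → Q x) →
               (∀ {x} → Q x → ∀ {a} → a ∈ B → x a ≡ 0#) →
               Satisfiable (P ∩ Q) → (P ∩ Q) IsFaceOf P
  ∩-isFaceOf {I} {P} {Q} B P≥0 vanish⇒Q Q⇒vanish (x₀ , x₀∈P , x₀∈Q) = ψ , to , from
    where
    ψ = -∑coordinates B
    ψ≡0 : ∀ {x} → Q x → apply ψ x ≡ 0#
    ψ≡0 x∈Q = trans (cong -_ (∑-zero _ (λ i → Q⇒vanish x∈Q (∈-lookup i)))) -0#≈0#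
    to : (P ∩ Q) ⊆ face ψ P
    to (x∈P , x∈Q) = x∈P , λ y y∈P → subst (apply ψ y ≤_) (sym (ψ≡0 x∈Q)) (0≤x⇒-x≤0 (∑-nonNegative _ (λ i → P≥0 y∈P (lookup B i))))
    from : face ψ P ⊆ (P ∩ Q)
    from {x} (x∈P , max) = x∈P , vanish⇒Q x∈P λ {a} a∈B →
      subst (λ b → x b ≡ 0#) (sym (lookup-index a∈B)) (vanish (index a∈B))
      where
      0≤x∘B : ∀ i → 0# ≤ x (lookup B i)
      0≤x∘B i = P≥0 x∈P (lookup B i)
      ∑≡0 : ∑ (x ∘ lookup B) ≡ 0#
      ∑≡0 = trans (sym (-‿involutive _)) (trans (cong -_ (≤-antisym
        (0≤x⇒-x≤0 (∑-nonNegative _ 0≤x∘B)) (subst (_≤ apply ψ x) (ψ≡0 x₀∈Q) (max x₀ x₀∈P)))) -0#≈0#)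
      vanish : ∀ i → x (lookup B i) ≡ 0#
      vanish = ∑-zero⇒zero _ 0≤x∘B ∑≡0

  module _ {V : Set} (_≟ⱽ_ : DecidableEquality V) where
    open DecMembership _≟ⱽ_ using (_∈?_)

    private
      simplex : List V → Region V
      simplex = hull (unit _≟ⱽ_)

    simplex-nonNegative : ∀ σ {x} → simplex σ x → ∀ v → 0# ≤ x v
    simplex-nonNegative σ (w , 0≤w , _ , x≡) v = subst (0# ≤_) (sym (x≡ v))
      (∑-nonNegative _ (λ i → *-nonNegative (0≤w i) (unit-nonNegative _≟ⱽ_ _ v)))

    simplex-support : ∀ σ {x v} → simplex σ x → x v ≢ 0# → v ∈ σ
    simplex-support σ {x} {v} (w , _ , _ , x≡) xv≢0
      with i , ≢0 ← ∑-nonZero⇒∃ _ (xv≢0 ∘ trans (x≡ v)) =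
      subst (_∈ σ) (unit-nonZero _≟ⱽ_ (λ u≡0 → ≢0 (trans (cong (w i *_) u≡0) (zeroʳ _)))) (∈-lookup i)

    simplex-outside : ∀ σ {x v} → simplex σ x → v ∉ σ → x v ≡ 0#
    simplex-outside σ {x} {v} x∈ v∉σ with x v ≟ 0#
    ... | yes xv≡0 = xv≡0
    ... | no  xv≢0 = ⊥-elim (v∉σ (simplex-support σ x∈ xv≢0))

    -- The coordinate at a vertex is the sum of all weights placed on it, since `σ` may repeat
    -- vertices; when it vanishes, so does each of these weights.
    simplex-restrict : ∀ σ τ {x} → simplex σ x → (∀ {v} → v ∈ σ → v ∉ τ → x v ≡ 0#) → simplex τ x
    simplex-restrict σ τ {x} x∈@(w , 0≤w , _ , x≡) vanish = hull-support (unit _≟ⱽ_) {v = lookup σ} x∈ keep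
      where
      keep : ∀ i → w i ≡ 0# ⊎ lookup σ i ∈ τ
      keep i with lookup σ i ∈? τ
      ... | yes v∈τ = inj₂ v∈τ
      ... | no  v∉τ = inj₁ (begin
        w i                                            ≡⟨ *-identityʳ (w i) ⟨
        w i * 1#                                       ≡⟨ cong (w i *_) (unit-diagonal _≟ⱽ_ (lookup σ i)) ⟨
        w i * unit _≟ⱽ_ (lookup σ i) (lookup σ i)
          ≡⟨ ∑-zero⇒zero (λ k → w k * unit _≟ⱽ_ (lookup σ k) (lookup σ i))
               (λ k → *-nonNegative (0≤w k) (unit-nonNegative _≟ⱽ_ _ _))
               (trans (sym (x≡ (lookup σ i))) (vanish (∈-lookup i) v∉τ)) i ⟩
        0#                                             ∎)

-- Lattice paths and uniqueness of weights in the staircase triangulation.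

private variable r s n n′ : ℕ

-- The form of `Monotone` for indexed families, so that it applies to the lookup of a list and to a
-- section `i ↦ (i , f i)` alike.
NonCrossing : (Fin n → Fin r × Fin s) → Set
NonCrossing v = ∀ k l → proj₁ (v k) Fin.< proj₁ (v l) → proj₂ (v k) Fin.≤ proj₂ (v l)

Monotone : List (Fin r × Fin s) → Set
Monotone L = ∀ {p q} → p ∈ L → q ∈ L → proj₁ p Fin.< proj₁ q → proj₂ p Fin.≤ proj₂ q

chainFrom-≥ : ∀ {i : Fin r} {j : Fin s} {L p} → ChainFrom i j L → p ∈ L → i Fin.≤ proj₁ p × j Fin.≤ proj₂ p
chainFrom-≥ (end _ _)     (here refl) = ℕ.≤-refl , ℕ.≤-refl
chainFrom-≥ (step₁ _ _)   (here refl) = ℕ.≤-refl , ℕ.≤-refl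
chainFrom-≥ (step₂ _ _)   (here refl) = ℕ.≤-refl , ℕ.≤-refl
chainFrom-≥ (step₁ i′≡ c) (there p∈) with i′≤ , j≤ ← chainFrom-≥ c p∈ =
  ℕ.≤-trans (ℕ.n≤1+n _) (subst (ℕ._≤ _) i′≡ i′≤) , j≤
chainFrom-≥ (step₂ j′≡ c) (there p∈) with i≤ , j′≤ ← chainFrom-≥ c p∈ =
  i≤ , ℕ.≤-trans (ℕ.n≤1+n _) (subst (ℕ._≤ _) j′≡ j′≤)

chainFrom-monotone : ∀ {i : Fin r} {j : Fin s} {L} → ChainFrom i j L → Monotone L
chainFrom-monotone c           p∈          (here refl) p₁<q₁ = ⊥-elim (ℕ.<⇒≱ p₁<q₁ (head≤ c p∈))
  where
  head≤ : ∀ {i : Fin r} {j : Fin s} {q L p} → ChainFrom i j (q ∷ L) → p ∈ q ∷ L → proj₁ q Fin.≤ proj₁ p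
  head≤ c@(end _ _)   p∈ = proj₁ (chainFrom-≥ c p∈)
  head≤ c@(step₁ _ _) p∈ = proj₁ (chainFrom-≥ c p∈)
  head≤ c@(step₂ _ _) p∈ = proj₁ (chainFrom-≥ c p∈)
chainFrom-monotone (step₁ _ c) (here refl) (there q∈)  _     = proj₂ (chainFrom-≥ c q∈)
chainFrom-monotone c@(step₂ _ _) (here refl) q∈@(there _)  _ = proj₂ (chainFrom-≥ c q∈)
chainFrom-monotone (step₁ _ c) (there p∈)  (there q∈)  p₁<q₁ = chainFrom-monotone c p∈ q∈ p₁<q₁
chainFrom-monotone (step₂ _ c) (there p∈)  (there q∈)  p₁<q₁ = chainFrom-monotone c p∈ q∈ p₁<q₁

partialPath-monotone : ((L , _) : PartialPath r s) → Monotone L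
partialPath-monotone (L , M , (_ , _ , _ , _ , c) , L⊆M) p∈ q∈ = chainFrom-monotone c (L⊆M p∈) (L⊆M q∈)

module StaircaseProperties {c ℓ} (K : OrderedField c ℓ) (r s : ℕ) where
  open OrderedField K
  open OrderedFieldProperties K
  open ConvexProperties K
  open Convex K hiding (cong)
  open ≡-Reasoning

  private
    PV : Fin r × Fin s → Point (Fin r ⊎ Fin s)
    PV = productVertex K r s

    -- Indicator of [0,α). The bound is a natural number rather than an element of `Fin n` because α
    -- = n occurs too.
    below : ∀ {n} → ℕ → Fin n → Carrier
    below α a = if does (toℕ a <? α) then 1# else 0#

    below-yes : ∀ {n α} {a : Fin n} → toℕ a ℕ.< α → below α a ≡ 1#
    below-yes {α = α} {a} a<α = cong (if_then 1# else 0#) (dec-true (toℕ a <? α) a<α)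

    below-no : ∀ {n α} {a : Fin n} → ¬ (toℕ a ℕ.< α) → below α a ≡ 0#
    below-no {α = α} {a} a≮α = cong (if_then 1# else 0#) (dec-false (toℕ a <? α) a≮α)

    below-suc : ∀ {n} (i a : Fin n) → below (ℕ.suc (toℕ i)) a ≡ below (toℕ i) a + unit _≟ᶠ_ i a
    below-suc i a with i ≟ᶠ a
    ... | yes refl = trans (below-yes {a = i} ℕ.≤-refl)
      (sym (trans (cong (_+ 1#) (below-no {a = i} (ℕ.<-irrefl refl))) (+-identityˡ 1#)))
    ... | no i≢a with toℕ a <? toℕ i
    ...   | yes a<i = trans (below-yes {a = a} (ℕ.m≤n⇒m≤1+n a<i))
      (sym (trans (cong (_+ 0#) (below-yes {a = a} a<i)) (+-identityʳ 1#)))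
    ...   | no  a≮i = trans (below-no {a = a} λ a<1+i → a≮i (ℕ.≤∧≢⇒< (ℕ.≤-pred a<1+i) (i≢a ∘ sym ∘ toℕ-injective)))
              (sym (trans (cong (_+ 0#) (below-no {a = a} a≮i)) (+-identityʳ 0#)))

    below-*≤ˡ : ∀ α β (a : Fin r) (b : Fin s) → below α a * below β b ≤ below α a
    below-*≤ˡ α β a b with does (toℕ a <? α) | does (toℕ b <? β)
    ... | true  | true  = ≤-reflexive (*-identityˡ 1#)
    ... | true  | false = subst (_≤ 1#) (sym (zeroʳ 1#)) 0≤1
    ... | false | _     = ≤-reflexive (zeroˡ _)

    below-*≤ʳ : ∀ α β (a : Fin r) (b : Fin s) → below α a * below β b ≤ below β b
    below-*≤ʳ α β a b with does (toℕ a <? α) | does (toℕ b <? β)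
    ... | true  | _     = ≤-reflexive (*-identityˡ _)
    ... | false | true  = subst (_≤ 1#) (sym (zeroˡ 1#)) 0≤1
    ... | false | false = ≤-reflexive (zeroˡ _)

    -- The right-hand side mentions only coordinates of the represented point, so two
    -- representations of one point have the same row sums and the same column sums.
    marginal : ∀ {n m} (w : Fin n → Carrier) (u : Fin n → Fin m) (y : Fin m → Carrier) →
               (∀ a → y a ≡ ∑ λ k → w k * unit _≟ᶠ_ (u k) a) →
               ∀ f → ∑ (λ k → w k * f (u k)) ≡ ∑ (λ a → y a * f a)
    marginal w u y y≡ f = sym (begin
      ∑ (λ a → y a * f a)
        ≡⟨ ∑-cong (λ a → trans (cong (_* f a) (y≡ a)) (*-distribʳ-sum (f a) (λ k → w k * unit _≟ᶠ_ (u k) a))) ⟩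
      ∑ (λ a → ∑ λ k → w k * unit _≟ᶠ_ (u k) a * f a)
        ≡⟨ ∑-comm (λ a k → w k * unit _≟ᶠ_ (u k) a * f a) ⟩
      ∑ (λ k → ∑ λ a → w k * unit _≟ᶠ_ (u k) a * f a)
        ≡⟨ ∑-cong (λ k → trans (∑-cong (λ a → *-assoc (w k) (unit _≟ᶠ_ (u k) a) (f a)))
             (sym (*-distribˡ-sum (w k) (λ a → unit _≟ᶠ_ (u k) a * f a)))) ⟩
      ∑ (λ k → w k * ∑ λ a → unit _≟ᶠ_ (u k) a * f a)
        ≡⟨ ∑-cong (λ k → cong (w k *_) (∑-unit (u k) f)) ⟩
      ∑ (λ k → w k * f (u k)) ∎)

    -- With indicators for `f` and `g` this is the weight lying in a rectangle of the grid; with two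
    -- unit vectors, the weight at one grid point.
    mass : ∀ {n} → (Fin n → Carrier) → (Fin n → Fin r × Fin s) → (Fin r → Carrier) → (Fin s → Carrier) → Carrier
    mass w v f g = ∑ λ k → w k * (f (proj₁ (v k)) * g (proj₂ (v k)))

    mass-+ˡ : ∀ {n} (w : Fin n → Carrier) v {f f₁ f₂} g → (∀ a → f a ≡ f₁ a + f₂ a) →
              mass w v f g ≡ mass w v f₁ g + mass w v f₂ g
    mass-+ˡ w v {f} {f₁} {f₂} g f≡ = trans
      (∑-cong λ k → trans (cong (λ y → w k * (y * g (proj₂ (v k)))) (f≡ _))
        (trans (cong (w k *_) (distribʳ (g (proj₂ (v k))) (f₁ (proj₁ (v k))) (f₂ (proj₁ (v k))))) (distribˡ (w k) _ _)))
      (∑-distrib-+ (λ k → w k * (f₁ (proj₁ (v k)) * g (proj₂ (v k)))) (λ k → w k * (f₂ (proj₁ (v k)) * g (proj₂ (v k)))))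

    mass-+ʳ : ∀ {n} (w : Fin n → Carrier) v f {g g₁ g₂} → (∀ b → g b ≡ g₁ b + g₂ b) →
              mass w v f g ≡ mass w v f g₁ + mass w v f g₂
    mass-+ʳ w v f {g} {g₁} {g₂} g≡ = trans
      (∑-cong λ k → trans (cong (λ y → w k * (f (proj₁ (v k)) * y)) (g≡ _))
        (trans (cong (w k *_) (distribˡ (f (proj₁ (v k))) (g₁ (proj₂ (v k))) (g₂ (proj₂ (v k))))) (distribˡ (w k) _ _)))
      (∑-distrib-+ (λ k → w k * (f (proj₁ (v k)) * g₁ (proj₂ (v k)))) (λ k → w k * (f (proj₁ (v k)) * g₂ (proj₂ (v k)))))

    -- A non-crossing v′ misses the upper left or the lower right complement of the
    -- corner [0,α) × [0,β), so the corner carries a full row or column marginal.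
    corner-≤ : ∀ {n n′ x} {v : Fin n → Fin r × Fin s} {v′ : Fin n′ → Fin r × Fin s} → NonCrossing v′ →
               ((w , _) : Conv (PV ∘ v) x) ((w′ , _) : Conv (PV ∘ v′) x) →
               ∀ α β → mass w v (below α) (below β) ≤ mass w′ v′ (below α) (below β)
    corner-≤ {n} {n′} {x} {v} {v′} nc (w , 0≤w , _ , x≡) (w′ , 0≤w′ , _ , x≡′) α β
      with any? (λ k → (toℕ (proj₁ (v′ k)) <? α) ×-dec (β ≤? toℕ (proj₂ (v′ k))))
    ... | no none = subst (mass w v (below α) (below β) ≤_)
        (trans (marginal w (proj₁ ∘ v) (x ∘ inj₁) (x≡ ∘ inj₁) (below α))
          (trans (sym (marginal w′ (proj₁ ∘ v′) (x ∘ inj₁) (x≡′ ∘ inj₁) (below α)))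
            (∑-cong (λ k → cong (w′ k *_) (full k)))))
        (∑-mono-≤ _ _ λ k → *-monoˡ-≤ (0≤w k) (below-*≤ˡ α β (proj₁ (v k)) (proj₂ (v k))))
      where
      full : ∀ k → below α (proj₁ (v′ k)) ≡ below α (proj₁ (v′ k)) * below β (proj₂ (v′ k))
      full k with toℕ (proj₁ (v′ k)) <? α
      ... | yes a<α = sym (trans (cong (below α (proj₁ (v′ k)) *_)
                        (below-yes {a = proj₂ (v′ k)} (ℕ.≰⇒> (λ β≤b → none (k , a<α , β≤b))))) (*-identityʳ _))
      ... | no  a≮α = trans (below-no {a = proj₁ (v′ k)} a≮α)
                        (sym (trans (cong (_* _) (below-no {a = proj₁ (v′ k)} a≮α)) (zeroˡ _)))
    ... | yes (k₀ , a₀<α , β≤b₀) = subst (mass w v (below α) (below β) ≤_)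
        (trans (marginal w (proj₂ ∘ v) (x ∘ inj₂) (x≡ ∘ inj₂) (below β))
          (trans (sym (marginal w′ (proj₂ ∘ v′) (x ∘ inj₂) (x≡′ ∘ inj₂) (below β)))
            (∑-cong (λ k → cong (w′ k *_) (full k)))))
        (∑-mono-≤ _ _ λ k → *-monoˡ-≤ (0≤w k) (below-*≤ʳ α β (proj₁ (v k)) (proj₂ (v k))))
      where
      full : ∀ k → below β (proj₂ (v′ k)) ≡ below α (proj₁ (v′ k)) * below β (proj₂ (v′ k))
      full k with toℕ (proj₁ (v′ k)) <? α
      ... | yes a<α = sym (trans (cong (_* _) (below-yes {a = proj₁ (v′ k)} a<α)) (*-identityˡ _))
      ... | no  a≮α = trans
        (below-no {a = proj₂ (v′ k)} (ℕ.≤⇒≯ (ℕ.≤-trans β≤b₀ (nc k₀ k (ℕ.<-≤-trans a₀<α (ℕ.≮⇒≥ a≮α))))))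
        (sym (trans (cong (_* _) (below-no {a = proj₁ (v′ k)} a≮α)) (zeroˡ _)))

  -- North-west corner rule: second differences of the corner masses are the weights.
  nonCrossing-support : ∀ {x} {v : Fin n → Fin r × Fin s} {v′ : Fin n′ → Fin r × Fin s} →
                        NonCrossing v → NonCrossing v′ →
                        ((w , _) : Conv (PV ∘ v) x) → Conv (PV ∘ v′) x →
                        ∀ k → w k ≢ 0# → ∃[ k′ ] v′ k′ ≡ v k
  nonCrossing-support {n} {n′} {x} {v} {v′} nc nc′ x∈@(w , 0≤w , _) x∈′@(w′ , _) k wk≢0 = found (∑-nonZero⇒∃ _ mass′≢0)
    where
    i = proj₁ (v k)
    j = proj₂ (v k)
    δi = unit _≟ᶠ_ i
    δj = unit _≟ᶠ_ j
    corner : ∀ α β → mass w v (below α) (below β) ≡ mass w′ v′ (below α) (below β)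
    corner α β = ≤-antisym (corner-≤ nc′ x∈ x∈′ α β) (corner-≤ nc x∈′ x∈ α β)
    cancel : ∀ {a b a′ b′ c c′} → c ≡ a + b → c′ ≡ a′ + b′ → c ≡ c′ → a ≡ a′ → b ≡ b′
    cancel {a} {b} {_} {b′} c≡ c′≡ c≡c′ refl = +-cancelˡ a b b′ (trans (sym c≡) (trans c≡c′ c′≡))
    strip : ∀ β → mass w v δi (below β) ≡ mass w′ v′ δi (below β)
    strip β = cancel (mass-+ˡ w v (below β) (below-suc i)) (mass-+ˡ w′ v′ (below β) (below-suc i))
      (corner (ℕ.suc (toℕ i)) β) (corner (toℕ i) β)
    cell≡ : mass w v δi δj ≡ mass w′ v′ δi δj
    cell≡ = cancel (mass-+ʳ w v δi (below-suc j)) (mass-+ʳ w′ v′ δi (below-suc j))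
      (strip (ℕ.suc (toℕ j))) (strip (toℕ j))
    mass≢0 : mass w v δi δj ≢ 0#
    mass≢0 ≡0 = wk≢0 (begin
      w k                  ≡⟨ trans (cong (w k *_) (*-identityˡ 1#)) (*-identityʳ (w k)) ⟨
      w k * (1# * 1#)      ≡⟨ cong (w k *_) (cong₂ _*_ (unit-diagonal _≟ᶠ_ i) (unit-diagonal _≟ᶠ_ j)) ⟨
      w k * (δi i * δj j)  ≡⟨ ∑-zero⇒zero (λ l → w l * (δi (proj₁ (v l)) * δj (proj₂ (v l))))
                                (λ l → *-nonNegative (0≤w l)
                                  (*-nonNegative (unit-nonNegative _≟ᶠ_ i _) (unit-nonNegative _≟ᶠ_ j _))) ≡0 k ⟩
      0#                   ∎)
    mass′≢0 : mass w′ v′ δi δj ≢ 0#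
    mass′≢0 = mass≢0 ∘ trans cell≡
    found : (∃[ k′ ] w′ k′ * (δi (proj₁ (v′ k′)) * δj (proj₂ (v′ k′))) ≢ 0#) → ∃[ k′ ] v′ k′ ≡ v k
    found (k′ , ≢0) = k′ , sym (cong₂ _,_
      (unit-nonZero _≟ᶠ_ λ δ≡0 → ≢0 (trans (cong (λ y → w′ k′ * (y * _)) δ≡0) (trans (cong (w′ k′ *_) (zeroˡ _)) (zeroʳ _))))
      (unit-nonZero _≟ᶠ_ λ δ≡0 → ≢0 (trans (cong (λ y → w′ k′ * (_ * y)) δ≡0) (trans (cong (w′ k′ *_) (zeroʳ _)) (zeroʳ _)))))

  private
    nonCrossing-lookup : ∀ {L : List (Fin r × Fin s)} → Monotone L → NonCrossing (lookup L)
    nonCrossing-lookup mono k l = mono (∈-lookup k) (∈-lookup l)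

    stair : List (Fin r × Fin s) → Region (Fin r ⊎ Fin s)
    stair = hull PV

  -- A vertex of `stair L` has a representation with all its weight on itself, and every
  -- representation over `M` has to use the same grid point.
  stair-cancel : ∀ {L M} → Monotone L → Monotone M → stair L ⊆ stair M → L ⊆ᴸ M
  stair-cancel {L} {M} monoL monoM L⊆M {p} p∈L =
    subst (_∈ M) (trans (proj₂ found) (sym (lookup-index p∈L))) (∈-lookup (proj₁ found))
    where
    k = index p∈L
    found : ∃[ k′ ] lookup M k′ ≡ lookup L k
    found = nonCrossing-support (nonCrossing-lookup monoL) (nonCrossing-lookup monoM)
      (vertex∈Conv (PV ∘ lookup L) k) (L⊆M (vertex∈Conv (PV ∘ lookup L) k)) k
      (λ u≡0 → 1≢0 (trans (sym (unit-diagonal _≟ᶠ_ k)) u≡0))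

  -- The combinatorial form of meeting the plane, on which every row carries the positive weight
  -- 1/r.
  Covers : List (Fin r × Fin s) → Set
  Covers L = ∀ i → ∃[ j ] (i , j) ∈ L

  module _ (r≢0 : r ≢ 0) where

    private
      r⁻¹ = fromℕ r ⁻¹

    fromℕr≢0 : fromℕ r ≢ 0#
    fromℕr≢0 = fromℕ-nonZero r≢0

    -- The barycentre of one grid point per row; equal weights 1/r put it on the plane.
    sectionPoint : (Fin r → Fin s) → Point (Fin r ⊎ Fin s)
    sectionPoint f a = ∑ λ i → r⁻¹ * PV (i , f i) a

    sectionPoint∈Conv : ∀ f → Conv (λ i → PV (i , f i)) (sectionPoint f)
    sectionPoint∈Conv f = (λ _ → r⁻¹) , (λ _ → ⁻¹-nonNegative (fromℕ-nonNegative r) fromℕr≢0) ,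
      trans (∑-const r r⁻¹) (*-inverseʳ _ fromℕr≢0) , λ _ → refl

    sectionPoint∈plane : ∀ f → plane K r s (sectionPoint f)
    sectionPoint∈plane f = lift λ a → trans
      (∑-cong (λ i → trans (*-comm _ _) (cong (_* r⁻¹) (unit-sym i a)))) (∑-unit a (λ _ → r⁻¹))
      where
      unit-sym : ∀ i a → unit _≟ᶠ_ i a ≡ unit _≟ᶠ_ a i
      unit-sym i a with i ≟ᶠ a | a ≟ᶠ i
      ... | yes _   | yes _   = refl
      ... | no  _   | no  _   = refl
      ... | yes i≡a | no  a≢i = ⊥-elim (a≢i (sym i≡a))
      ... | no  i≢a | yes a≡i = ⊥-elim (i≢a (sym a≡i))

    sectionPoint∈stair : ∀ {L} f → (∀ i → (i , f i) ∈ L) → stair L (sectionPoint f)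
    sectionPoint∈stair f f∈L = hull-support PV {v = λ i → i , f i} (sectionPoint∈Conv f) (λ i → inj₂ (f∈L i))

    covers⇒satisfiable : ∀ {L} → Covers L → Satisfiable (stair L ∩ plane K r s)
    covers⇒satisfiable cov = sectionPoint (proj₁ ∘ cov) , sectionPoint∈stair _ (proj₂ ∘ cov) , sectionPoint∈plane (proj₁ ∘ cov)

    satisfiable⇒covers : ∀ {L} → Satisfiable (stair L ∩ plane K r s) → Covers L
    satisfiable⇒covers {L} (x , (w , _ , _ , x≡) , lift x₁≡) i
      with k , ≢0 ← ∑-nonZero⇒∃ _ (⁻¹-nonZero fromℕr≢0 ∘ trans (sym (x₁≡ i)) ∘ trans (x≡ (inj₁ i)))
      with refl ← unit-nonZero _≟ᶠ_ {proj₁ (lookup L k)} {i} (λ u≡0 → ≢0 (trans (cong (w k *_) u≡0) (zeroʳ _)))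
      = proj₂ (lookup L k) , ∈-lookup k

    -- To detect `p`, take a section of `L` through `p`. It is non-crossing as part of `L`, and its
    -- barycentre has non-zero weight at `p`, so any representation over `M` must use `p`.
    slice-cancel : ∀ {L M} → Monotone L → Monotone M → Covers L →
                   (stair L ∩ plane K r s) ⊆ (stair M ∩ plane K r s) → L ⊆ᴸ M
    slice-cancel {L} {M} monoL monoM cov L⊆M {i₀ , j₀} p∈L =
      subst (_∈ M) (trans (proj₂ found) (cong (i₀ ,_) f≡)) (∈-lookup (proj₁ found))
      where
      -- The last component remembers that the section passes through `(i₀ , j₀)`; the other rows
      -- use any point that `cov` provides.
      choice : ∀ i → ∃[ j ] (i , j) ∈ L × (i ≡ i₀ → j ≡ j₀)
      choice i with i ≟ᶠ i₀
      ... | yes refl = j₀ , p∈L , λ _ → refl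
      ... | no i≢i₀  = proj₁ (cov i) , proj₂ (cov i) , ⊥-elim ∘ i≢i₀
      f = proj₁ ∘ choice
      f∈L : ∀ i → (i , f i) ∈ L
      f∈L = proj₁ ∘ proj₂ ∘ choice
      f≡ : f i₀ ≡ j₀
      f≡ = proj₂ (proj₂ (choice i₀)) refl
      found : ∃[ k′ ] lookup M k′ ≡ (i₀ , f i₀)
      found = nonCrossing-support (λ k l → monoL (f∈L k) (f∈L l)) (nonCrossing-lookup monoM)
        (sectionPoint∈Conv f) (proj₁ (L⊆M (sectionPoint∈stair f f∈L , sectionPoint∈plane f))) i₀ (⁻¹-nonZero fromℕr≢0)

-- A criterion for containing a copy.

module _ {c ℓ} (K : OrderedField c ℓ) where
  open Convex K

  -- Equality of cells is mutual inclusion, so preserving and reflecting inclusions already makes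
  -- `to` an isomorphism onto its image. Being a face of the second cell follows from `meets` with
  -- the two cells exchanged.
  containsCopy : ∀ {I J} {F : Family I} {G : Family J} (to : Index G → Index F) →
    (∀ a b → cell G a ⊆ cell G b → cell F (to a) ⊆ cell F (to b)) →
    (∀ a b → cell F (to a) ⊆ cell F (to b) → cell G a ⊆ cell G b) →
    (∀ a φ → Satisfiable (face φ (cell F (to a))) → ∃[ b ] cell F (to b) ≐ face φ (cell F (to a))) →
    (∀ a b → Satisfiable (cell F (to a) ∩ cell F (to b)) →
             (cell F (to a) ∩ cell F (to b)) IsFaceOf cell F (to a)) →
    F ContainsCopyOf G
  containsCopy {F = F} {G} to mono cancel faces meets = record
    { subfamily  = λ i → ∃[ a ] i ≡ to a
    ; subcomplex = record
      { face-closed  = λ { (_ , a , refl) φ sat → let b , eq = faces a φ sat in (to b , b , refl) , eq }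
      ; intersection = λ { (_ , a , refl) (_ , b , refl) sat → meets a b sat , swapped a b sat }
      }
    ; isomorphic = record
      { to                 = λ a → to a , a , refl
      ; isOrderIsomorphism = record
        { isOrderMonomorphism = record
          { isOrderHomomorphism = record
            { cong = λ {a} {b} (a⊆b , b⊆a) → mono a b a⊆b , mono b a b⊆a
            ; mono = λ {a} {b} → mono a b
            }
          ; injective = λ {a} {b} (a⊆b , b⊆a) → cancel a b a⊆b , cancel b a b⊆a
          ; cancel    = λ {a} {b} → cancel a b
          }
        ; surjective = λ { (_ , a , refl) → a , λ {b} (b⊆a , a⊆b) → mono b a b⊆a , mono a b a⊆b }
        }
      }
    }
    where
    swapped : ∀ a b → Satisfiable (cell F (to a) ∩ cell F (to b)) →
              (cell F (to a) ∩ cell F (to b)) IsFaceOf cell F (to b)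
    swapped a b (x , x∈a , x∈b) with φ , to-face , from-face ← meets b a (x , x∈b , x∈a) =
      φ , to-face ∘ swap , swap ∘ from-face

-- Projected cells spanned by a placed grid: inclusions, faces, intersections.

module _ {g s : ℕ} where

  row : Fin g → List (Fin g × Fin s) → List (Fin g × Fin s)
  row i = filter (λ p → proj₁ p ≟ᶠ i)

-- Placements d of a g × s grid in a graph for which the rows of every monotone
-- list of grid points form a simplex of Hom₊(K_g, H).
record Placement (g s : ℕ) (H : Graph) : Set where
  open Graph H
  field
    d         : Fin g × Fin s → V
    injective : ∀ {p q} → d p ≡ d q → p ≡ q
    adjacent  : ∀ {i i′ j j′} → i Fin.< i′ → j Fin.≤ j′ → Adj (d (i , j)) (d (i′ , j′))

module Copies {c ℓ} (K : OrderedField c ℓ) {g s} {H : Graph} (P : Placement g s H) where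
  open OrderedField K
  open OrderedFieldProperties K
  open ConvexProperties K
  open Convex K hiding (cong; restrict)
  open Projection K g H
  open Graph H hiding (_≟_)
  open Placement P
  open DecMembership (Graph._≟_ H) using (_∈?_)

  private
    e : V → Point V
    e = unit (Graph._≟_ H)

  block : List (Fin g × Fin s) → Fin g → List V
  block L i = map d (row i L)

  ∈-block⁺ : ∀ {L i j} → (i , j) ∈ L → d (i , j) ∈ block L i
  ∈-block⁺ p∈ = ∈-map⁺ d (∈-filter⁺ _ p∈ refl)

  ∈-block⁻ : ∀ {L i v} → v ∈ block L i → ∃[ j ] (i , j) ∈ L × v ≡ d (i , j)
  ∈-block⁻ {L} v∈ with (i , j) , p∈ , v≡ ← ∈-map⁻ d v∈ with p∈L , refl ← ∈-filter⁻ _ {xs = L} p∈ = j , p∈L , v≡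

  ∈-block-d : ∀ {L i i′ j} → d (i , j) ∈ block L i′ → i ≡ i′ × (i , j) ∈ L
  ∈-block-d {L} v∈ with j′ , p∈ , eq ← ∈-block⁻ {L} v∈ with refl ← injective eq = refl , p∈

  blockSimplex : ∀ {L} → Monotone L → Hom₊Simplex g H
  blockSimplex {L} mono = record { σ = block L ; compatible = compat }
    where
    compat : ∀ {i i′} → i ≢ i′ → ∀ {u v} → u ∈ block L i → v ∈ block L i′ → Adj u v
    compat {i} {i′} i≢i′ u∈ v∈ with j , p∈ , refl ← ∈-block⁻ {L} u∈ | j′ , q∈ , refl ← ∈-block⁻ {L} v∈
      with ℕ.<-cmp (toℕ i) (toℕ i′)
    ... | tri< i<i′ _ _ = adjacent i<i′ (mono p∈ q∈ i<i′)
    ... | tri≈ _ i≡i′ _ = ⊥-elim (i≢i′ (toℕ-injective i≡i′))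
    ... | tri> _ _ i′<i = sym-Adj (adjacent i′<i (mono q∈ p∈ i′<i))

  allBlocks : List (Fin g × Fin s) → List V
  allBlocks L = concat (tabulate (block L))

  ∈-allBlocks⁺ : ∀ {L p} → p ∈ L → d p ∈ allBlocks L
  ∈-allBlocks⁺ {L} {i , _} p∈ = ∈-concat⁺′ (∈-block⁺ p∈) (∈-tabulate⁺ {f = block L} i)

  ∈-allBlocks⁻ : ∀ {L v} → v ∈ allBlocks L → ∃[ p ] p ∈ L × v ≡ d p
  ∈-allBlocks⁻ {L} v∈ with _ , v∈σ , σ∈ ← ∈-concat⁻′ (tabulate (block L)) v∈
    with i , refl ← ∈-tabulate⁻ σ∈ with j , p∈ , v≡ ← ∈-block⁻ {L} v∈σ = (i , j) , p∈ , v≡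

  ∈-allBlocks-d : ∀ {L p} → d p ∈ allBlocks L → p ∈ L
  ∈-allBlocks-d {L} v∈ with q , q∈ , eq ← ∈-allBlocks⁻ {L} v∈ with refl ← injective eq = q∈

  hull₊ : List (Fin g × Fin s) → Region V
  hull₊ L = simplexOn (allBlocks L)

  hull₊-mono : ∀ {L M} → L ⊆ᴸ M → hull₊ L ⊆ hull₊ M
  hull₊-mono {L} {M} L⊆M = hull-mono e {allBlocks L} {allBlocks M} λ v∈ → embed (∈-allBlocks⁻ {L} v∈)
    where
    embed : ∀ {v} → ∃[ p ] p ∈ L × v ≡ d p → v ∈ allBlocks M
    embed (p , p∈ , refl) = ∈-allBlocks⁺ {M} (L⊆M p∈)

  hull₊-cancel : ∀ {L M} → hull₊ L ⊆ hull₊ M → L ⊆ᴸ M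
  hull₊-cancel {L} {M} L⊆M {p} p∈ = ∈-allBlocks-d {M} (simplex-support (Graph._≟_ H) (allBlocks M)
    (L⊆M (vertex∈hull e {L = allBlocks L} (∈-allBlocks⁺ {L} p∈)))
    (λ eq → 1≢0 (trans (sym (unit-diagonal (Graph._≟_ H) (d p))) eq)))

  -- The maximal vertices are selected on the grid instead of in `V`, so that the face again comes
  -- from a sublist of `L`.
  hull₊-face : ∀ {L} φ {x} → face φ (hull₊ L) x →
               ∃[ M ] M ⊆ᴸ L × hull₊ M ≐ face φ (hull₊ L)
  hull₊-face {L} φ {x} x∈ = L′ , (proj₁ ∘ ∈-filter⁻ (best? ∘ d) {xs = L}) ,
                            proj₁ F ∘ hull-mono e {allBlocks L′} {filter best? (allBlocks L)} shrink ,
                            hull-mono e {filter best? (allBlocks L)} {allBlocks L′} grow ∘ proj₂ F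
    where
    best? = λ v → apply φ (e v) ≟ apply φ x
    L′ = filter (best? ∘ d) L
    F = face-hull e {allBlocks L} φ x∈
    shrink : allBlocks L′ ⊆ᴸ filter best? (allBlocks L)
    shrink v∈ with p , p∈ , refl ← ∈-allBlocks⁻ {L′} v∈ with p∈L , best ← ∈-filter⁻ (best? ∘ d) {xs = L} p∈ =
      ∈-filter⁺ best? (∈-allBlocks⁺ {L} p∈L) best
    grow : filter best? (allBlocks L) ⊆ᴸ allBlocks L′
    grow v∈ with v∈L , best ← ∈-filter⁻ best? {xs = allBlocks L} v∈ with p , p∈ , refl ← ∈-allBlocks⁻ {L} v∈L =
      ∈-allBlocks⁺ {L′} (∈-filter⁺ (best? ∘ d) p∈ best)

  -- The coordinates to be annihilated are those of the vertices of `L` outside `M`.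
  hull₊-meet : ∀ L M → Satisfiable (hull₊ L ∩ hull₊ M) → (hull₊ L ∩ hull₊ M) IsFaceOf hull₊ L
  hull₊-meet L M = ∩-isFaceOf (filter (λ v → ¬? (v ∈? allBlocks M)) (allBlocks L))
    (simplex-nonNegative (Graph._≟_ H) (allBlocks L))
    (λ x∈ vanish → simplex-restrict (Graph._≟_ H) (allBlocks L) (allBlocks M) x∈
      λ v∈ v∉ → vanish (∈-filter⁺ (λ v → ¬? (v ∈? allBlocks M)) v∈ v∉))
    (λ x∈ v∈ → simplex-outside (Graph._≟_ H) (allBlocks M) x∈ (proj₂ (∈-filter⁻ (λ v → ¬? (v ∈? allBlocks M)) {xs = allBlocks L} v∈)))

  module _ (g≢0 : g ≢ 0) where

    private
      t = fromℕ g ⁻¹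

      fromℕg≢0 : fromℕ g ≢ 0#
      fromℕg≢0 = fromℕ-nonZero g≢0

      t≢0 : t ≢ 0#
      t≢0 = ⁻¹-nonZero fromℕg≢0

      0≤t : 0# ≤ t
      0≤t = ⁻¹-nonNegative (fromℕ-nonNegative g) fromℕg≢0

    hull× : List (Fin g × Fin s) → Region V
    hull× L = t · Minkowski (simplexOn ∘ block L)

    hull×-nonNegative : ∀ {L x} → hull× L x → ∀ v → 0# ≤ x v
    hull×-nonNegative {L} (z , (y , y∈ , z≡) , x≡) v = subst (0# ≤_) (sym (x≡ v)) (*-nonNegative 0≤t
      (subst (0# ≤_) (sym (z≡ v)) (∑-nonNegative _ (λ i → simplex-nonNegative (Graph._≟_ H) (block L i) (y∈ i) v))))

    hull×-support : ∀ {L x p} → hull× L x → x (d p) ≢ 0# → p ∈ L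
    hull×-support {L} {x} {p} (z , (y , y∈ , z≡) , x≡) x≢0
      with i , yi≢0 ← ∑-nonZero⇒∃ (λ i → y i (d p))
             (λ ∑≡0 → x≢0 (trans (x≡ (d p)) (trans (cong (t *_) (trans (z≡ (d p)) ∑≡0)) (zeroʳ t))))
      = proj₂ (∈-block-d {L} (simplex-support (Graph._≟_ H) (block L i) (y∈ i) yi≢0))

    hull×-mono : ∀ {L M} → L ⊆ᴸ M → hull× L ⊆ hull× M
    hull×-mono {L} {M} L⊆M = Minkowski-mono {P = simplexOn ∘ block L} {simplexOn ∘ block M}
      λ i → hull-mono e {block L i} {block M i} λ v∈ → embed (∈-block⁻ {L} v∈)
      where
      embed : ∀ {i v} → ∃[ j ] (i , j) ∈ L × v ≡ d (i , j) → v ∈ block M i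
      embed (j , p∈ , refl) = ∈-block⁺ (L⊆M p∈)

    -- Choose one grid point per row, taking `p` in its own row. The average of the corresponding
    -- unit vectors lies in the cell of `L` and is non-zero at `d p`, which forces `p` into `M`.
    hull×-cancel : ∀ {L M} → (∀ i → ∃[ j ] (i , j) ∈ L) → hull× L ⊆ hull× M → L ⊆ᴸ M
    hull×-cancel {L} {M} cov L⊆M {i₀ , j₀} p∈ = hull×-support {M} (L⊆M x∈) x≢0
      where
      choice : ∀ i → ∃[ j ] (i , j) ∈ L × (i ≡ i₀ → j ≡ j₀)
      choice i with i ≟ᶠ i₀
      ... | yes refl = j₀ , p∈ , λ _ → refl
      ... | no i≢i₀  = proj₁ (cov i) , proj₂ (cov i) , ⊥-elim ∘ i≢i₀
      y : Fin g → Point V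
      y i = e (d (i , proj₁ (choice i)))
      z x : Point V
      z a = ∑ λ i → y i a
      x a = t * z a
      x∈ : hull× L x
      x∈ = z , (y , (λ i → vertex∈hull e {L = block L i} (∈-block⁺ (proj₁ (proj₂ (choice i))))) , λ _ → refl) , λ _ → refl
      x≢0 : x (d (i₀ , j₀)) ≢ 0#
      x≢0 x≡0 = 1≢0 (trans (sym (unit-diagonal (Graph._≟_ H) (d (i₀ , j₀))))
        (trans (cong (λ j → e (d (i₀ , j)) (d (i₀ , j₀))) (sym (proj₂ (proj₂ (choice i₀)) refl)))
          (∑-zero⇒zero (λ i → y i (d (i₀ , j₀))) (λ i → unit-nonNegative (Graph._≟_ H) _ _) (*-zero-cancelˡ t≢0 x≡0) i₀)))

    -- The summands of a point are non-negative, so a coordinate that vanishes in the sum vanishes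
    -- in each summand. As `d` is injective, a diagonal of row i missing from `block M i` is missing
    -- from all blocks of `M`; hence the same summands show membership in the cell of `M`.
    hull×-meet : ∀ L M → Satisfiable (hull× L ∩ hull× M) → (hull× L ∩ hull× M) IsFaceOf hull× L
    hull×-meet L M = ∩-isFaceOf (filter (λ v → ¬? (v ∈? allBlocks M)) (allBlocks L))
      (hull×-nonNegative {L}) restrict outside
      where
      restrict : ∀ {x} → hull× L x → (∀ {v} → v ∈ filter (λ v → ¬? (v ∈? allBlocks M)) (allBlocks L) → x v ≡ 0#) → hull× M x
      restrict {x} (z , (y , y∈ , z≡) , x≡) vanish =
        z , (y , (λ i → simplex-restrict (Graph._≟_ H) (block L i) (block M i) (y∈ i) (yi≡0 i)) , z≡) , x≡
        where
        yi≡0 : ∀ i {v} → v ∈ block L i → v ∉ block M i → y i v ≡ 0#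
        yi≡0 i v∈ v∉ with j , p∈ , refl ← ∈-block⁻ {L} v∈ =
          ∑-zero⇒zero (λ i → y i (d (i₀ , j))) (λ i → simplex-nonNegative (Graph._≟_ H) (block L i) (y∈ i) _)
            (trans (sym (z≡ _)) (*-zero-cancelˡ t≢0 (trans (sym (x≡ _))
              (vanish (∈-filter⁺ (λ v → ¬? (v ∈? allBlocks M)) (∈-allBlocks⁺ {L} p∈)
                (λ v∈M → v∉ (∈-block⁺ (∈-allBlocks-d {M} v∈M)))))))) i₀
          where i₀ = i
      outside : ∀ {x} → hull× M x → ∀ {v} → v ∈ filter (λ v → ¬? (v ∈? allBlocks M)) (allBlocks L) → x v ≡ 0#
      outside {x} x∈ {v} v∈ with v∈L , v∉M ← ∈-filter⁻ (λ v → ¬? (v ∈? allBlocks M)) {xs = allBlocks L} v∈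
        with p , _ , refl ← ∈-allBlocks⁻ {L} v∈L with x (d p) ≟ 0#
      ... | yes x≡0 = x≡0
      ... | no  x≢0 = ⊥-elim (v∉M (∈-allBlocks⁺ {M} (hull×-support {M} x∈ x≢0)))

    -- By `face-Minkowski` the summands are maximised separately. Each row has its own maximum, so
    -- the filter compares with the summand `y i` of a maximiser. The face of each summand is
    -- non-empty, which is why no row is lost.
    hull×-face : ∀ {L} φ {x} → face φ (hull× L) x →
                 ∃[ M ] M ⊆ᴸ L × (∀ i → ∃[ j ] (i , j) ∈ M) × hull× M ≐ face φ (hull× L)
    hull×-face {L} φ {x} x∈ with _ , (y , y∈ , _) , _ ← proj₁ (face-Minkowski 0≤t t≢0 φ (simplexOn ∘ block L)) x∈ =
      L′ , (proj₁ ∘ ∈-filter⁻ (λ p → best? (proj₁ p) (d p)) {xs = L}) , covers ,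
      (proj₂ M ∘ Minkowski-mono {P = simplexOn ∘ block L′} {face φ ∘ simplexOn ∘ block L}
        (λ i → proj₁ (F i) ∘ hull-mono e {block L′ i} {best i} (shrink i))) ,
      (Minkowski-mono {P = face φ ∘ simplexOn ∘ block L} {simplexOn ∘ block L′}
        (λ i → hull-mono e {best i} {block L′ i} (grow i) ∘ proj₂ (F i)) ∘ proj₁ M)
      where
      M = face-Minkowski 0≤t t≢0 φ (simplexOn ∘ block L)
      best? : ∀ i v → Dec (apply φ (e v) ≡ apply φ (y i))
      best? i v = apply φ (e v) ≟ apply φ (y i)
      L′ = filter (λ p → best? (proj₁ p) (d p)) L
      best : Fin g → List V
      best i = filter (best? i) (block L i)
      F : ∀ i → hull e (best i) ≐ face φ (hull e (block L i))
      F i = face-hull e {block L i} φ (y∈ i)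
      shrink : ∀ i → block L′ i ⊆ᴸ best i
      shrink i v∈ with j , p∈ , refl ← ∈-block⁻ {L′} v∈ with p∈L , b ← ∈-filter⁻ (λ p → best? (proj₁ p) (d p)) {xs = L} p∈ =
        ∈-filter⁺ (best? i) (∈-block⁺ p∈L) b
      grow : ∀ i → best i ⊆ᴸ block L′ i
      grow i v∈ with v∈L , b ← ∈-filter⁻ (best? i) {xs = block L i} v∈ with j , p∈ , refl ← ∈-block⁻ {L} v∈L =
        ∈-block⁺ (∈-filter⁺ (λ p → best? (proj₁ p) (d p)) p∈ b)
      covers : ∀ i → ∃[ j ] (i , j) ∈ L′
      covers i with v , v∈ ← hull-nonEmpty e {best i} (proj₂ (F i) (y∈ i)) with j , p∈ , _ ← ∈-block⁻ {L′} (grow i v∈) = j , p∈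

open import Data.Nat.Base using (_+_; _*_; _∸_; _≤_)

-- Embedding Σ(r,s) and 𝒞(r,s) along a placement with at least r rows.

module _ {c ℓ} (K : OrderedField c ℓ) {g s H} (P : Placement g (ℕ.suc s) H) {r} (r≤g : r ≤ g) (r≢0 : r ≢ 0) where
  open ConvexProperties K
  open Convex K hiding (cong)
  open StaircaseProperties K r (ℕ.suc s)
  open Copies K P
  open Placement P using (d)

  open DecMembership (≡-dec (_≟ᶠ_ {g}) (_≟ᶠ_ {ℕ.suc s})) using (_∈?_)

  private
    Grid = List (Fin r × Fin (ℕ.suc s))

    e = unit (Graph._≟_ H)

    ι : Fin r × Fin (ℕ.suc s) → Fin g × Fin (ℕ.suc s)
    ι (i , j) = inject≤ i r≤g , j

    ι-injective : ∀ {p q} → ι p ≡ ι q → p ≡ q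
    ι-injective {i , j} {i′ , j′} eq = cong₂ _,_ (inject≤-injective r≤g r≤g i i′ (cong proj₁ eq)) (cong proj₂ eq)

    ∈-map-ι : ∀ {L p} → ι p ∈ map ι L → p ∈ L
    ∈-map-ι ιp∈ with q , q∈ , eq ← ∈-map⁻ ι ιp∈ with refl ← ι-injective eq = q∈

    map-ι-mono : ∀ {L M} → L ⊆ᴸ M → map ι L ⊆ᴸ map ι M
    map-ι-mono L⊆M v∈ with p , p∈ , refl ← ∈-map⁻ ι v∈ = ∈-map⁺ ι (L⊆M p∈)

    map-ι-monotone : ∀ {L} → Monotone L → Monotone (map ι L)
    map-ι-monotone mono p∈ q∈ p<q with (i , _) , p∈L , refl ← ∈-map⁻ ι p∈ | (i′ , _) , q∈L , refl ← ∈-map⁻ ι q∈ =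
      mono p∈L q∈L (subst₂ ℕ._<_ (toℕ-inject≤ i r≤g) (toℕ-inject≤ i′ r≤g) p<q)

    subPath : ∀ ((L , _) : PartialPath r (ℕ.suc s)) {M} → M ⊆ᴸ L → PartialPath r (ℕ.suc s)
    subPath (_ , N , path , L⊆N) {M} M⊆L = M , N , path , L⊆N ∘ M⊆L

    -- A face arises as a list of points of the larger grid; this turns it back into a sublist of
    -- the original path.
    pullback : List (Fin g × Fin (ℕ.suc s)) → Grid → Grid
    pullback M = filter (λ v → ι v ∈? M)

    pullback-⊆ : ∀ {M L} → pullback M L ⊆ᴸ L
    pullback-⊆ {M} {L} = proj₁ ∘ ∈-filter⁻ (λ v → ι v ∈? M) {xs = L}

    map-pullback⁻ : ∀ {M L} → map ι (pullback M L) ⊆ᴸ M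
    map-pullback⁻ {M} {L} v∈ with v , v∈L′ , refl ← ∈-map⁻ ι v∈ = proj₂ (∈-filter⁻ (λ v → ι v ∈? M) {xs = L} v∈L′)

    map-pullback⁺ : ∀ {M L v} → v ∈ map ι L → v ∈ M → v ∈ map ι (pullback M L)
    map-pullback⁺ {M} v∈L v∈M with v , v∈ , refl ← ∈-map⁻ ι v∈L = ∈-map⁺ ι (∈-filter⁺ (λ v → ι v ∈? M) v∈ v∈M)

  πHom₊-containsCopyOf-staircase : Projection.πHom₊ K g H ContainsCopyOf staircase K r (ℕ.suc s)
  πHom₊-containsCopyOf-staircase = containsCopy K {F = πHom₊} {staircase K r (ℕ.suc s)} to mono cancel faces meets
    where
    open Projection K g H using (πHom₊)
    to : Index (staircase K r (ℕ.suc s)) → Index πHom₊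
    to (lift p) = lift (blockSimplex {map ι (proj₁ p)} (map-ι-monotone (partialPath-monotone p)))
    mono : ∀ a b → cell (staircase K r (ℕ.suc s)) a ⊆ cell (staircase K r (ℕ.suc s)) b →
           cell πHom₊ (to a) ⊆ cell πHom₊ (to b)
    mono (lift p) (lift q) p⊆q = hull₊-mono {map ι (proj₁ p)} {map ι (proj₁ q)}
      (map-ι-mono (stair-cancel {proj₁ p} {proj₁ q} (partialPath-monotone p) (partialPath-monotone q) p⊆q))
    cancel : ∀ a b → cell πHom₊ (to a) ⊆ cell πHom₊ (to b) →
             cell (staircase K r (ℕ.suc s)) a ⊆ cell (staircase K r (ℕ.suc s)) b
    cancel (lift p) (lift q) p⊆q = hull-mono (productVertex K r (ℕ.suc s)) {proj₁ p} {proj₁ q}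
      λ v∈ → ∈-map-ι (hull₊-cancel {map ι (proj₁ p)} {map ι (proj₁ q)} p⊆q (∈-map⁺ ι v∈))
    meets : ∀ a b → Satisfiable (cell πHom₊ (to a) ∩ cell πHom₊ (to b)) →
            (cell πHom₊ (to a) ∩ cell πHom₊ (to b)) IsFaceOf cell πHom₊ (to a)
    meets (lift p) (lift q) = hull₊-meet (map ι (proj₁ p)) (map ι (proj₁ q))
    faces : ∀ a φ → Satisfiable (face φ (cell πHom₊ (to a))) → ∃[ b ] cell πHom₊ (to b) ≐ face φ (cell πHom₊ (to a))
    faces (lift p) φ (x , x∈) =
      lift (subPath p {pullback M L} (pullback-⊆ {M} {L})) ,
      (λ {y} y∈ → proj₁ F {y} (hull₊-mono {map ι (pullback M L)} {M} (map-pullback⁻ {M} {L}) {y} y∈)) ,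
      (λ {y} y∈ → hull₊-mono {M} {map ι (pullback M L)} (λ v∈ → map-pullback⁺ (M⊆L v∈) v∈) {y} (proj₂ F {y} y∈))
      where
      L = proj₁ p
      subface = hull₊-face {map ι L} φ {x} x∈
      M = proj₁ subface
      M⊆L = proj₁ (proj₂ subface)
      F = proj₂ (proj₂ subface)

  private
    top : Fin (ℕ.suc s)
    top = Fin.fromℕ s

    tops : List (Fin g × Fin (ℕ.suc s))
    tops = map (_, top) (filter (λ i → r ≤? toℕ i) (allFin g))

    -- Since `top` dominates every column, the rows from r on do not obstruct any path.
    pad : Grid → List (Fin g × Fin (ℕ.suc s))
    pad L = map ι L ++ tops

    ∈-tops⁺ : ∀ {i} → r ≤ toℕ i → (i , top) ∈ tops
    ∈-tops⁺ r≤i = ∈-map⁺ (_, top) (∈-filter⁺ (λ i → r ≤? toℕ i) (∈-allFin _) r≤i)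

    ∈-tops⁻ : ∀ {p} → p ∈ tops → r ≤ toℕ (proj₁ p) × proj₂ p ≡ top
    ∈-tops⁻ p∈ with i , i∈ , refl ← ∈-map⁻ (_, top) p∈ = proj₂ (∈-filter⁻ (λ i → r ≤? toℕ i) {xs = allFin g} i∈) , refl

    toℕ-ι< : ∀ p → toℕ (proj₁ (ι p)) ℕ.< r
    toℕ-ι< (i , _) = subst (ℕ._< r) (sym (toℕ-inject≤ i r≤g)) (toℕ<n i)

    ∈-pad-ι : ∀ {L p} → ι p ∈ pad L → p ∈ L
    ∈-pad-ι {L} {p} ιp∈ with ∈-++⁻ (map ι L) ιp∈
    ... | inj₁ ∈L = ∈-map-ι ∈L
    ... | inj₂ ∈T = ⊥-elim (ℕ.<⇒≱ (toℕ-ι< p) (proj₁ (∈-tops⁻ ∈T)))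

    pad-mono : ∀ {L M} → L ⊆ᴸ M → pad L ⊆ᴸ pad M
    pad-mono {L} {M} L⊆M v∈ with ∈-++⁻ (map ι L) v∈
    ... | inj₁ ∈L = ∈-++⁺ˡ (map-ι-mono L⊆M ∈L)
    ... | inj₂ ∈T = ∈-++⁺ʳ (map ι M) ∈T

    pad-monotone : ∀ {L} → Monotone L → Monotone (pad L)
    pad-monotone {L} mono {p} {q} p∈ q∈ p<q with ∈-++⁻ (map ι L) p∈ | ∈-++⁻ (map ι L) q∈
    ... | inj₁ p∈L | inj₁ q∈L = map-ι-monotone mono p∈L q∈L p<q
    ... | _        | inj₂ q∈T = subst (proj₂ p Fin.≤_) (sym (proj₂ (∈-tops⁻ q∈T))) (≤fromℕ (proj₂ p))
    ... | inj₂ p∈T | inj₁ q∈L with q′ , _ , refl ← ∈-map⁻ ι q∈L =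
      ⊥-elim (ℕ.<⇒≱ (ℕ.<-trans p<q (toℕ-ι< q′)) (proj₁ (∈-tops⁻ p∈T)))

    ι-surjective : ∀ {i} → toℕ i ℕ.< r → ∃[ i′ ] inject≤ {r} {g} i′ r≤g ≡ i
    ι-surjective i<r = fromℕ< i<r , toℕ-injective (trans (toℕ-inject≤ (fromℕ< i<r) r≤g) (toℕ-fromℕ< i<r))

    pad-covers : ∀ {L} → Covers L → ∀ i → ∃[ j ] (i , j) ∈ pad L
    pad-covers {L} cov i with toℕ i <? r
    ... | no  i≮r = top , ∈-++⁺ʳ (map ι L) (∈-tops⁺ (ℕ.≮⇒≥ i≮r))
    ... | yes i<r with i′ , refl ← ι-surjective {i} i<r = proj₁ (cov i′) , ∈-++⁺ˡ (∈-map⁺ ι (proj₂ (cov i′)))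

    g≢0 : g ≢ 0
    g≢0 refl = r≢0 (ℕ.n≤0⇒n≡0 r≤g)

    path : Index (𝒞 K r (ℕ.suc s)) → PartialPath r (ℕ.suc s)
    path (lift p , _) = p

    covers : ∀ a → Covers (proj₁ (path a))
    covers (lift p , sat) = satisfiable⇒covers r≢0 {proj₁ p} sat

    pad-pullback⁺ : ∀ {M L} → M ⊆ᴸ pad L → M ⊆ᴸ pad (pullback M L)
    pad-pullback⁺ {M} {L} M⊆L v∈ with ∈-++⁻ (map ι L) (M⊆L v∈)
    ... | inj₁ ∈L = ∈-++⁺ˡ (map-pullback⁺ ∈L v∈)
    ... | inj₂ ∈T = ∈-++⁺ʳ (map ι (pullback M L)) ∈T

    -- In the rows from `r` on, `pad L` has the single point `top`. A face meets every row, so it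
    -- must keep that point, and padding the pullback adds nothing new.
    pad-pullback⁻ : ∀ {M L} → M ⊆ᴸ pad L → (∀ i → ∃[ j ] (i , j) ∈ M) → pad (pullback M L) ⊆ᴸ M
    pad-pullback⁻ {M} {L} M⊆L cov {i , j} v∈ with ∈-++⁻ (map ι (pullback M L)) v∈
    ... | inj₁ ∈L′ = map-pullback⁻ {M} {L} ∈L′
    ... | inj₂ ∈T with j′ , ∈M ← cov i with ∈-++⁻ (map ι L) (M⊆L ∈M)
    ...   | inj₁ ∈L with p , _ , eq ← ∈-map⁻ ι ∈L =
      ⊥-elim (ℕ.<⇒≱ (toℕ-ι< p) (subst (r ≤_) (cong (toℕ ∘ proj₁) eq) (proj₁ (∈-tops⁻ ∈T))))
    ...   | inj₂ ∈T′ = subst (λ j → (i , j) ∈ M) (trans (proj₂ (∈-tops⁻ ∈T′)) (sym (proj₂ (∈-tops⁻ ∈T)))) ∈M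

    pullback-covers : ∀ {M L} → M ⊆ᴸ pad L → (∀ i → ∃[ j ] (i , j) ∈ M) → Covers (pullback M L)
    pullback-covers {M} {L} M⊆L cov i with j , ∈M ← cov (inject≤ i r≤g) =
      j , ∈-pad-ι {pullback M L} (pad-pullback⁺ {M} {L} M⊆L ∈M)

  πHom-containsCopyOf-𝒞 : Projection.πHom K g H ContainsCopyOf 𝒞 K r (ℕ.suc s)
  πHom-containsCopyOf-𝒞 = containsCopy K {F = πHom} {G} to mono cancel faces meets
    where
    open Projection K g H using (πHom)
    G = 𝒞 K r (ℕ.suc s)
    nonEmpty : ∀ {A : Set} {v : A} {σ} → v ∈ σ → σ ≢ []
    nonEmpty () refl
    to : Index G → Index πHom
    to a = lift (record
      { simplex  = blockSimplex {pad (proj₁ (path a))} (pad-monotone (partialPath-monotone (path a)))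
      ; nonEmpty = λ i → nonEmpty (∈-block⁺ (proj₂ (pad-covers (covers a) i)))
      })
    mono : ∀ a b → cell G a ⊆ cell G b → cell πHom (to a) ⊆ cell πHom (to b)
    mono a b a⊆b = hull×-mono g≢0 {pad (proj₁ (path a))} {pad (proj₁ (path b))}
      (pad-mono (slice-cancel r≢0 {proj₁ (path a)} {proj₁ (path b)}
        (partialPath-monotone (path a)) (partialPath-monotone (path b)) (covers a) a⊆b))
    cancel : ∀ a b → cell πHom (to a) ⊆ cell πHom (to b) → cell G a ⊆ cell G b
    cancel a b a⊆b (x∈a , x∈plane) = hull-mono (productVertex K r (ℕ.suc s)) {proj₁ (path a)} {proj₁ (path b)}
      (λ v∈ → ∈-pad-ι (hull×-cancel g≢0 {pad (proj₁ (path a))} {pad (proj₁ (path b))}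
        (pad-covers (covers a)) a⊆b (∈-++⁺ˡ (∈-map⁺ ι v∈)))) x∈a , x∈plane
    meets : ∀ a b → Satisfiable (cell πHom (to a) ∩ cell πHom (to b)) →
            (cell πHom (to a) ∩ cell πHom (to b)) IsFaceOf cell πHom (to a)
    meets a b = hull×-meet g≢0 (pad (proj₁ (path a))) (pad (proj₁ (path b)))
    faces : ∀ a φ → Satisfiable (face φ (cell πHom (to a))) → ∃[ b ] cell πHom (to b) ≐ face φ (cell πHom (to a))
    faces a φ (x , x∈) =
      (lift (subPath (path a) {L′} (pullback-⊆ {M} {L})) ,
        covers⇒satisfiable r≢0 {L′} (pullback-covers {M} {L} M⊆L cov)) ,
      (λ {y} y∈ → proj₁ F {y} (hull×-mono g≢0 {pad L′} {M} (pad-pullback⁻ {M} {L} M⊆L cov) {y} y∈)) ,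
      (λ {y} y∈ → hull×-mono g≢0 {M} {pad L′} (pad-pullback⁺ {M} {L} M⊆L) {y} (proj₂ F {y} y∈))
      where
      L = proj₁ (path a)
      subface = hull×-face g≢0 {pad L} φ {x} x∈
      M = proj₁ subface
      M⊆L = proj₁ (proj₂ subface)
      cov = proj₁ (proj₂ (proj₂ subface))
      F = proj₂ (proj₂ (proj₂ subface))
      L′ = pullback M L

-- Dissections of polygons with a suitable number of vertices.

splitAt-length : ∀ {A : Set} n (P : List A) → n ℕ.< length P → ∃[ ys ] ∃[ b ] ∃[ zs ] P ≡ ys ++ b ∷ zs × length ys ≡ n
splitAt-length ℕ.zero    (b ∷ zs) _         = [] , b , zs , refl , refl
splitAt-length (ℕ.suc n) (y ∷ P)  (s≤s n<) with ys , b , zs , refl , refl ← splitAt-length n P n< =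
  y ∷ ys , b , zs , refl , refl

split-tabulate : ∀ {A : Set} {n} (f : Fin n → A) b → ∃[ ys ] ∃[ zs ] tabulate f ≡ ys ++ f b ∷ zs × length ys ≡ toℕ b
split-tabulate f zero    = [] , tabulate (f ∘ suc) , refl , refl
split-tabulate f (suc b) with ys , zs , eq , len ← split-tabulate (f ∘ suc) b =
  f zero ∷ ys , zs , cong (f zero ∷_) eq , cong ℕ.suc len

split₂-tabulate : ∀ {A : Set} {n} (f : Fin n → A) a b l → toℕ b ≡ ℕ.suc (toℕ a + l) →
                  ∃[ xs ] ∃[ ys ] ∃[ zs ] tabulate f ≡ xs ++ f a ∷ ys ++ f b ∷ zs × length ys ≡ l
split₂-tabulate f zero    (suc b) l eq with ys , zs , split , len ← split-tabulate (f ∘ suc) b =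
  [] , ys , zs , cong (f zero ∷_) split , trans len (ℕ.suc-injective eq)
split₂-tabulate f (suc a) (suc b) l eq with xs , ys , zs , split , len ← split₂-tabulate (f ∘ suc) a b l (ℕ.suc-injective eq) =
  f zero ∷ xs , ys , zs , cong (f zero ∷_) split , len

-- Cut off an ear: the first vertex, the next `q` and the one after them form a k-gon with k = q +
-- 2, and the remaining polygon has `q` vertices fewer.
dissect : ∀ {V : Set} q t (P : List V) → length P ≡ ℕ.suc t * q + 2 → ∃[ D ] Dissection (2 + q) P (ℕ.suc t) D
dissect q ℕ.zero    P       len = [] , whole (trans len (lemma q))
  where
  lemma : ∀ q → 1 * q + 2 ≡ 2 + q
  lemma = solve-∀
dissect q (ℕ.suc t) []      len = ⊥-elim (ℕ.1+n≢0 (sym (trans len (ℕ.+-comm _ 2))))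
dissect {V} q (ℕ.suc t) (a ∷ P) len = cutOff (splitAt-length q P q<)
  where
  length-P : length P ≡ q + (ℕ.suc t * q + 1)
  length-P = ℕ.suc-injective (trans len (lemma q t))
    where
    lemma : ∀ q t → ℕ.suc (ℕ.suc t) * q + 2 ≡ ℕ.suc (q + (ℕ.suc t * q + 1))
    lemma = solve-∀
  q< : q ℕ.< length P
  q< = subst (q ℕ.<_) (sym length-P) (ℕ.m<m+n q (ℕ.m≤n+m 1 (ℕ.suc t * q)))
  cutOff : ∃[ ys ] ∃[ b ] ∃[ zs ] P ≡ ys ++ b ∷ zs × length ys ≡ q → ∃[ D ] Dissection (2 + q) (a ∷ P) (ℕ.suc (ℕ.suc t)) D
  cutOff (ys , b , zs , refl , refl) = _ ,
    cut [] ys zs (whole (cong ℕ.suc (trans (length-++ ys) (ℕ.+-comm _ 1)))) (proj₂ (dissect (length ys) t (a ∷ b ∷ zs) length-rest))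
    where
    length-rest : 2 + length zs ≡ ℕ.suc t * length ys + 2
    length-rest = trans (cong ℕ.suc (ℕ.+-cancelˡ-≡ (length ys) _ _ (trans (sym (length-++ ys)) length-P))) (sym (ℕ.+-suc _ 1))

-- With `length ys` a positive multiple of `q`, both polygons beside the diagonal have vertex counts
-- to which `dissect` applies.
dissect-along : ∀ {V : Set} q t u xs (a : V) ys b zs → length ys ≡ ℕ.suc t * q →
                length (xs ++ a ∷ ys ++ b ∷ zs) ≡ (ℕ.suc t + ℕ.suc u) * q + 2 →
                ∃[ D ] Dissection (2 + q) (xs ++ a ∷ ys ++ b ∷ zs) (ℕ.suc t + ℕ.suc u) ((a , b) ∷ D)
dissect-along q t u xs a ys b zs len-ys len = _ ,
  cut xs ys zs (proj₂ (dissect q t (a ∷ ys ++ [ b ]) length-inside)) (proj₂ (dissect q u (xs ++ a ∷ b ∷ zs) length-outside))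
  where
  length-inside : length (a ∷ ys ++ [ b ]) ≡ ℕ.suc t * q + 2
  length-inside = trans (cong ℕ.suc (trans (length-++ ys) (cong (_+ 1) len-ys))) (sym (ℕ.+-suc _ 1))
  length-outside : length (xs ++ a ∷ b ∷ zs) ≡ ℕ.suc u * q + 2
  length-outside = ℕ.+-cancelˡ-≡ (ℕ.suc t * q) _ _ (begin
    ℕ.suc t * q + length (xs ++ a ∷ b ∷ zs)           ≡⟨ cong₂ _+_ (sym len-ys) (length-++ xs) ⟩
    length ys + (length xs + (2 + length zs))         ≡⟨ lemma₁ (length ys) (length xs) (length zs) ⟩
    length xs + ℕ.suc (length ys + ℕ.suc (length zs)) ≡⟨ cong (λ n → length xs + ℕ.suc n) (length-++ ys) ⟨
    length xs + length (a ∷ ys ++ b ∷ zs)             ≡⟨ length-++ xs ⟨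
    length (xs ++ a ∷ ys ++ b ∷ zs)                   ≡⟨ len ⟩
    (ℕ.suc t + ℕ.suc u) * q + 2                       ≡⟨ lemma₂ q t u ⟩
    ℕ.suc t * q + (ℕ.suc u * q + 2)                   ∎)
    where
    open ≡-Reasoning
    lemma₁ : ∀ y x z → y + (x + (2 + z)) ≡ x + ℕ.suc (y + ℕ.suc z)
    lemma₁ = solve-∀
    lemma₂ : ∀ q t u → (ℕ.suc t + ℕ.suc u) * q + 2 ≡ ℕ.suc t * q + (ℕ.suc u * q + 2)
    lemma₂ = solve-∀

-- The diagonals d(i,j), with q = k - 2 and g = m - 1.

module _ (q g s : ℕ) (s≤1+q : s ≤ ℕ.suc q) .{{_ : ℕ.NonZero q}} where

  private
    k = 2 + q
    m = ℕ.suc g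
    N = vertexCount k m

  -- The end of the diagonal that starts at vertex j and cuts off g ∸ i many k-gons.
  far : ℕ → ℕ → ℕ
  far i j = ℕ.suc (j + (g ∸ i) * q)

  col≤q : (j : Fin s) → toℕ j ≤ q
  col≤q j = ℕ.≤-pred (ℕ.≤-trans (toℕ<n j) s≤1+q)

  -- Row 0 and column `q` give N - 1, the last vertex; this is where the bound s ≤ k - 1 is tight.
  far< : ∀ i (j : Fin s) → far i (toℕ j) ℕ.< N
  far< i j = subst (_≤ N) (ℕ.+-comm _ 2) (ℕ.+-monoˡ-≤ 2 (ℕ.+-mono-≤ (col≤q j) (ℕ.*-monoˡ-≤ q (ℕ.m∸n≤m g i))))

  near< : ∀ (j : Fin s) → toℕ j ℕ.< N
  near< j = ℕ.<-trans (s≤s (ℕ.m≤m+n (toℕ j) _)) (far< 0 j)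

  chord : Fin g × Fin s → Chord k m
  chord (i , j) = fromℕ< (near< j) , fromℕ< (far< (toℕ i) j)

  near-chord : ∀ i j → toℕ (proj₁ (chord (i , j))) ≡ toℕ j
  near-chord i j = toℕ-fromℕ< (near< j)

  far-chord : ∀ i j → toℕ (proj₂ (chord (i , j))) ≡ far (toℕ i) (toℕ j)
  far-chord i j = toℕ-fromℕ< (far< (toℕ i) j)

  chord-injective : ∀ {p p′} → chord p ≡ chord p′ → p ≡ p′
  chord-injective {i , j} {i′ , j′} eq
    with refl ← toℕ-injective {i = j} {j′} (trans (sym (near-chord i j)) (trans (cong (toℕ ∘ proj₁) eq) (near-chord i′ j′)))
    = cong (_, j) (toℕ-injective (ℕ.∸-cancelˡ-≡ (ℕ.<⇒≤ (toℕ<n i)) (ℕ.<⇒≤ (toℕ<n i′))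
        (ℕ.*-cancelʳ-≡ _ _ q (ℕ.+-cancelˡ-≡ (toℕ j) _ _ (ℕ.suc-injective
          (trans (sym (far-chord i j)) (trans (cong (toℕ ∘ proj₂) eq) (far-chord i′ j))))))))

  chord-allowable : ∀ p → Allowable k m (chord p)
  chord-allowable (i , j)
    with xs , ys , zs , split , len ← split₂-tabulate (λ v → v) (proj₁ (chord (i , j))) (proj₂ (chord (i , j)))
           ((g ∸ toℕ i) * q) (trans (far-chord i j) (cong (λ a → ℕ.suc (a + (g ∸ toℕ i) * q)) (sym (near-chord i j))))
    = subst (λ P → ∃[ D ] Dissection k P m D × chord (i , j) ∈ D) (sym split)
        (subst (λ n → ∃[ D ] Dissection k (xs ++ proj₁ (chord (i , j)) ∷ ys ++ proj₂ (chord (i , j)) ∷ zs) n D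
                        × chord (i , j) ∈ D) pieces
          (_ , proj₂ along , here refl))
    where
    -- The diagonal has g - i many k-gons on one side and i + 1 on the other. Both counts are
    -- positive and appear as successors, as `dissect-along` requires.
    t = g ∸ ℕ.suc (toℕ i)
    suc-t : ℕ.suc t ≡ g ∸ toℕ i
    suc-t = sym (ℕ.+-∸-assoc 1 (toℕ<n i))
    pieces : ℕ.suc t + ℕ.suc (toℕ i) ≡ m
    pieces = trans (cong (_+ ℕ.suc (toℕ i)) suc-t) (trans (ℕ.+-suc _ _) (cong ℕ.suc (ℕ.m∸n+n≡m (ℕ.<⇒≤ (toℕ<n i)))))
    along = dissect-along q t (toℕ i) xs (proj₁ (chord (i , j))) ys (proj₂ (chord (i , j))) zs
      (trans len (cong (_* q) (sym suc-t)))
      (trans (cong length (sym split)) (trans (length-tabulate (λ v → v)) (cong (λ n → n * q + 2) (sym pieces))))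

  -- One row outweighs all columns: j′ ≤ q and i < i′ give j′ + (g - i′) q ≤ (g - i) q, so the chord
  -- of the earlier row ends no earlier. The other order of alternation would need j′ < j.
  chord-noncrossing : ∀ {i i′ j j′} → i Fin.< i′ → j Fin.≤ j′ → ¬ Crossing (chord (i , j)) (chord (i′ , j′))
  chord-noncrossing {i} {i′} {j} {j′} i<i′ j≤j′ (inj₂ (j′<j , _)) =
    ℕ.<⇒≱ (subst₂ ℕ._<_ (near-chord i′ j′) (near-chord i j) j′<j) j≤j′
  chord-noncrossing {i} {i′} {j} {j′} i<i′ j≤j′ (inj₁ (_ , _ , far<far′)) =
    ℕ.<⇒≱ (subst₂ ℕ._<_ (far-chord i j) (far-chord i′ j′) far<far′)
      (s≤s (ℕ.≤-trans (ℕ.+-monoˡ-≤ _ (col≤q j′))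
        (ℕ.≤-trans (ℕ.*-monoˡ-≤ q (ℕ.∸-monoʳ-< i<i′ (ℕ.<⇒≤ (toℕ<n i′)))) (ℕ.m≤n+m _ _))))

  diagonals : Placement g s (I k m)
  diagonals = record
    { d         = diagonal
    ; injective = chord-injective ∘ cong value
    ; adjacent  = λ i<i′ j≤j′ →
        (λ eq → ℕ.<-irrefl (cong (toℕ ∘ proj₁) (chord-injective (cong value eq))) i<i′) , chord-noncrossing i<i′ j≤j′
    }
    where
    diagonal : Fin g × Fin s → δ k m
    diagonal p = chord p , Irrelevant.[ chord-allowable p ]

-- Here k = 3 + q. For r ≥ g + 1 the bound would give (g + 1)(k - 1) ≤ g (k - 2) + 2, but the left
-- side exceeds the right by g + q. So g = q = 0, which is the excluded case.
rows≤diagonals : ∀ q g r → ¬ (3 + q ≡ 3 × ℕ.suc g ≡ 1) → r * (2 + q) ≤ g * (1 + q) + 2 → r ≤ g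
rows≤diagonals q g r exclude bound with r ≤? g
... | yes r≤g = r≤g
... | no  r≰g = ⊥-elim (exclude (cong (3 +_) (ℕ.m+n≡0⇒n≡0 g g+q≡0) , cong ℕ.suc (ℕ.m+n≡0⇒m≡0 g g+q≡0)))
  where
  lemma : ∀ q g → ℕ.suc g * (2 + q) ≡ g * (1 + q) + 2 + (g + q)
  lemma = solve-∀
  g+q≡0 : g + q ≡ 0
  g+q≡0 = ℕ.n≤0⇒n≡0 (ℕ.+-cancelˡ-≤ (g * (1 + q) + 2) _ _ (subst₂ _≤_ (lemma q g) (sym (ℕ.+-identityʳ _))
    (ℕ.≤-trans (ℕ.*-monoˡ-≤ (2 + q) (ℕ.≰⇒> r≰g)) bound)))

theorem5p1 : ∀ {c ℓ} (K : OrderedField c ℓ) (k m r s : ℕ) → let open Convex K in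
    3 ≤ k → 1 ≤ m → ¬ (k ≡ 3 × m ≡ 1) →
    1 ≤ r → r * (k ∸ 1) ≤ (m ∸ 1) * (k ∸ 2) + 2 →
    1 ≤ s → s ≤ k ∸ 1 →
    (𝖣₊ K k m ContainsCopyOf staircase K r s) ×
    (𝖣 K k m ContainsCopyOf 𝒞 K r s)
theorem5p1 K (ℕ.suc (ℕ.suc (ℕ.suc q))) (ℕ.suc g) (ℕ.suc r) (ℕ.suc s) (s≤s (s≤s (s≤s _))) _ exclude _ bound _ s≤ =
  πHom₊-containsCopyOf-staircase K P r≤g (λ ()) , πHom-containsCopyOf-𝒞 K P r≤g (λ ())
  where
  P = diagonals (ℕ.suc q) g (ℕ.suc s) s≤
  r≤g = rows≤diagonals q g (ℕ.suc r) exclude bound
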